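{- Let $p\le q$ be positive integers with $\gcd(p,q)=1$, let $k\ge2$, and set $m_{(0,0)}=0$. Then \[ m_{(kq,kp)}=m^{\circ}_{\frac pq}\,m_{((k-1)q,(k-1)p)}-m_{((k-2)q,(k-2)p)}. \]
   Context: Lattice. Use the lattice of unit segments on the lines $y=c$, $x=c$, $y=-x+c$ ($c\in\mathbb Z$). Sign sequence of an oriented path. Let $\delta$ be an oriented path from one lattice point to another, transverse to the lattice segments it crosses, crossing $\sigma_1,\ldots,\sigma_N$ in order at points $s_i$. Its sign sequence is $(f_0,\ldots,f_{2N})$, defined as follows. - $f_0=-$ and $f_{2N}=+$. - $f_{2i-1}=-$ if $s_i$ is closer to the endpoint of $\sigma_i$ to the right of $\delta$, and $+$ if closer to the left endpoint (either sign if at the midpoint). - $f_{2i}=-$ if the common endpoint of $\sigma_i,\sigma_{i+1}$ lies to the right of $\delta$, and $+$ otherwise. Its continued fraction is $[a_1,\ldots,a_n]$, where the $a_i$ are the lengths of the maximal blocks of consecutive equal signs. Here $[a_1,\ldots,a_n]=a_1+1/(a_2+1/(\cdots+1/a_n))$, and $\mathcal N[\cdots]$ is its numerator in lowest terms. Definition of $m_{(kq,kp)}$. For coprime $p\le q$ and $k\ge1$, let $\delta$ be the segment from $(0,0)$ to $(kq,kp)$, deformed near each lattice point $(iq,ip)$, $1\le i\le k-1$, to pass around it by a small half-circle on its left. Define $m_{(kq,kp)}=\mathcal N$ of the continued fraction of the sign sequence of $\delta$. For $k=1$ this is the generalized Markov number $m_{\frac pq}$. Generalized Markov numbers. Start from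 the three positions with labels $\tfrac01,\tfrac10,\tfrac{ -1}1$, each carrying the number $1$. Mutating a position with label $\tfrac ef$ and number $z$ (the others having labels $\tfrac ab,\tfrac cd$ and numbers $x,y$) replaces the label by $\tfrac{a+c}{b+d}$ (or $\tfrac{c-a}{d-b}$ if $\tfrac ef=\tfrac{a+c}{b+d}$) and $z$ by $(x^2+xy+y^2)/z$. Use sequences starting at $\tfrac{ -1}1$, then $\tfrac10$, with no immediate repetition; $m_{\frac pq}$ is the number carried by label $\tfrac pq$. Definition of $m^\circ_{\frac pq}$. Let $\mathcal O_3$ be the once-punctured sphere with three orbifold points of order 3, with initial triangulation $T_0$ of pending arcs $\tau_{\frac01},\tau_{\frac10},\tau_{\frac{ -1}1}$, represented by lattice segments of slope $0,\infty,-1$. Move the endpoints of the segment $(0,0)\to(q,p)$ to $(\epsilon,\epsilon)$ and $(q+\epsilon,p+\epsilon)$, nudge it to avoid $(q,p)$, and identify the endpoints. This gives a simple closed curve on $\mathcal O_3$. $m^\circ_{\frac pq}$ is the number of good matchings of its band graph with respect to $T_0$, i.e. the number of perfect matchings of the underlying snake graph containing at least one of the two glued edges. It does not depend on the nudging direction.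
   Formalization: The sign at a crossing exactly at the midpoint of a segment is fixed to +, instead of "either sign"; for k≥2 the value depends on this choice, and with − the claim fails (p=1, q=2, k=2 gives 1027, not 77·13=1001). -}

module Defs where

open import Data.Bool using (Bool; true; false; _∧_; _∨_; not; if_then_else_)
open import Data.Nat using (ℕ; zero; suc; _+_; _*_; _∸_; _≡ᵇ_; _<ᵇ_; _/_; _%_)
open import Data.Nat.GCD using (gcd)
open import Data.Product using (_×_; _,_; proj₁; proj₂)
open import Data.List using (List; []; _∷_; _++_; [_]; map; concatMap; filter; length; take; drop; applyUpTo; foldr)
open import Relation.Nullary.Decidable using (Dec; yes; no)
open import Relation.Binary.PropositionalEquality using (_≡_)
open import Data.Bool using (T)
open import Data.Bool.Properties using (T?)

-- Basic arithmetic helpers (total versions of floor division / remainder;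
-- only ever used with a positive divisor).

divN : ℕ → ℕ → ℕ
divN a zero    = 0
divN a (suc n) = a / suc n

modN : ℕ → ℕ → ℕ
modN a zero    = a
modN a (suc n) = a % suc n

Pt : Set
Pt = ℕ × ℕ

_==ᵖ_ : Pt → Pt → Bool
(a , b) ==ᵖ (c , d) = (a ≡ᵇ c) ∧ (b ≡ᵇ d)

data Sign : Set where
  plus minus : Sign

_==ˢ_ : Sign → Sign → Bool
plus  ==ˢ plus  = true
minus ==ˢ minus = true
_     ==ˢ _     = false

-- "lies to the right of δ"  ↦  minus ;  "to the left"  ↦  plus
sideSign : Bool → Sign
sideSign true  = minus
sideSign false = plus

-- Convention for a crossing exactly at the midpoint of the crossed segment
-- (the paper allows either sign).
tieSign : Sign
tieSign = plus

-- Crossings of an oriented path with unit lattice segments.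
-- A crossing records the crossed segment σ = [u,v], which endpoint the
-- crossing point s is closer to, and the (local) side of δ on which a
-- point lies ("onRight w = true" iff w lies to the right of δ there).

data Near : Set where
  nearU nearV atMid : Near

record Crossing : Set where
  constructor crossing
  field
    u v     : Pt
    near    : Near
    onRight : Pt → Bool

open Crossing

oddSign : Crossing → Sign
oddSign c with near c
... | nearU = sideSign (onRight c (u c))
... | nearV = sideSign (onRight c (v c))
... | atMid = tieSign

commonEnd : Crossing → Crossing → Pt
commonEnd c d =
  if (u c ==ᵖ u d) ∨ (u c ==ᵖ v d) then u c else v c

evenSign : Crossing → Crossing → Sign
evenSign c d = sideSign (onRight c (commonEnd c d))

innerSigns : List Crossing → List Sign
innerSigns []            = []
innerSigns (c ∷ [])      = oddSign c ∷ []
innerSigns (c ∷ d ∷ cs)  = oddSign c ∷ evenSign c d ∷ innerSigns (d ∷ cs)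

signSeq : List Crossing → List Sign
signSeq cs = minus ∷ innerSigns cs ++ [ plus ]

-- The path δ from (0,0) to (kq,kp) along the line through the origin of
-- direction (q,p), deformed by a small left half-circle around each interior
-- lattice point (iq,ip).  Positions along the line are parametrised by an
-- integer time T ∈ {1,…,kL-1}, L = p q (p+q), the point at time T being
-- (Tq/L , Tp/L); every crossing of the line with a line x=c, y=c or x+y=c
-- happens at such a time.

comp : ℕ → ℕ → Near      -- compare 2r with L: offset r of s from u (scaled by L)
comp r L = if (2 * r) <ᵇ L then nearU else (if L <ᵇ (2 * r) then nearV else atMid)

module Path (q p : ℕ) where

  L : ℕ
  L = p * q * (p + q)

  rightOfLine : Pt → Bool
  rightOfLine (wx , wy) = (q * wy) <ᵇ (p * wx)

  -- small half-circle on the left of δ around the lattice point P = (a,b):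
  -- for a direction (q,p) with 0 < p ≤ q it crosses, in this order, the unit
  -- segments from P pointing west, north-west and north, each close to P,
  -- with P on its right and the other endpoint on its left.
  detour : Pt → List Crossing
  detour (a , b) =
      crossing P (a ∸ 1 , b)     nearU onR
    ∷ crossing P (a ∸ 1 , suc b) nearU onR
    ∷ crossing P (a , suc b)     nearU onR
    ∷ []
    where
      P = (a , b)
      onR : Pt → Bool
      onR w = w ==ᵖ P

  crossingsAt : ℕ → List Crossing
  crossingsAt T =
    if vert ∧ hor then detour (divN X L , divN Y L)
    else if vert then
      [ crossing (divN X L , divN Y L) (divN X L , suc (divN Y L))
                 (comp (modN Y L) L) rightOfLine ]
    else if hor then
      [ crossing (divN X L , divN Y L) (suc (divN X L) , divN Y L)
                 (comp (modN X L) L) rightOfLine ]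
    else if anti then
      [ crossing (divN X L , divN (X + Y) L ∸ divN X L)
                 (suc (divN X L) , divN (X + Y) L ∸ divN X L ∸ 1)
                 (comp (modN X L) L) rightOfLine ]
    else []
    where
      X = T * q
      Y = T * p
      vert = modN X L ≡ᵇ 0
      hor  = modN Y L ≡ᵇ 0
      anti = modN (X + Y) L ≡ᵇ 0

  pathCrossings : ℕ → List Crossing
  pathCrossings k = concatMap crossingsAt (applyUpTo suc (k * L ∸ 1))

blocks : List Sign → List ℕ
blocks ss = map proj₂ (foldr step [] ss)
  where
    step : Sign → List (Sign × ℕ) → List (Sign × ℕ)
    step s [] = (s , 1) ∷ []
    step s ((t , n) ∷ rest) =
      if s ==ˢ t then (t , suc n) ∷ rest else (s , 1) ∷ (t , n) ∷ rest

cfFrac : List ℕ → ℕ × ℕ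
cfFrac []       = (1 , 0)
cfFrac (a ∷ as) = (a * proj₁ r + proj₂ r , proj₁ r)
  where r = cfFrac as

cfNumerator : List ℕ → ℕ
cfNumerator as = divN (proj₁ (cfFrac as)) (gcd (proj₁ (cfFrac as)) (proj₂ (cfFrac as)))

mLat : (q p k : ℕ) → ℕ
mLat q p zero    = 0
mLat q p (suc k) = cfNumerator (blocks (signSeq (Path.pathCrossings q p (suc k))))

-- Snake graphs from sign sequences, and good matchings of band graphs.
-- Tiles are unit squares in ℕ²; the snake graph with sign sequence
-- (f_0,…,f_d) has tiles G_1,…,G_d and distinguished edges e_0,…,e_d with
-- e_{i-1}, e_i sides of G_i, opposite sides iff f_{i-1} ≠ f_i; e_0 is the
-- south side of G_1 and G_{i+1} is glued to G_i along e_i.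

Edge : Set
Edge = Pt × Pt

_==ᵉ_ : Edge → Edge → Bool
(a , b) ==ᵉ (c , d) = (a ==ᵖ c) ∧ (b ==ᵖ d)

data Side : Set where
  sS sN sW sE : Side

sideEdge : Pt → Side → Edge
sideEdge (x , y) sS = ((x , y) , (suc x , y))
sideEdge (x , y) sN = ((x , suc y) , (suc x , suc y))
sideEdge (x , y) sW = ((x , y) , (x , suc y))
sideEdge (x , y) sE = ((suc x , y) , (suc x , suc y))

-- exit side of a tile entered through side s (s ∈ {S,W})
oppSide turnSide : Side → Side
oppSide sS = sN
oppSide sW = sE
oppSide s  = s
turnSide sS = sE
turnSide sW = sN
turnSide s  = s

otherSides : Side → List Side
otherSides sS = sN ∷ sW ∷ sE ∷ []
otherSides sW = sS ∷ sN ∷ sE ∷ []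
otherSides sN = sS ∷ sW ∷ sE ∷ []
otherSides sE = sS ∷ sN ∷ sW ∷ []

newVerts : Pt → Side → List Pt
newVerts (x , y) sS = (x , suc y) ∷ (suc x , suc y) ∷ []
newVerts (x , y) sW = (suc x , y) ∷ (suc x , suc y) ∷ []
newVerts (x , y) _  = []

record Snake : Set where
  constructor snake
  field
    edges    : List Edge
    vertices : List Pt
    lastEdge : Edge

-- tiles from the current one on; arguments: position and entering side of
-- the current tile, previous sign f_{i-1}, remaining signs f_i,…,f_d
build : Pt → Side → Sign → List Sign → Snake
build pos ent f []      = snake [] [] (sideEdge pos ent)
build pos ent f (g ∷ gs) with (if f ==ˢ g then turnSide ent else oppSide ent)
... | ex with gs
...   | [] = snake (map (sideEdge pos) (otherSides ent)) (newVerts pos ent) (sideEdge pos ex)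
...   | _ ∷ _ =
        snake (map (sideEdge pos) (otherSides ent) ++ Snake.edges rest)
              (newVerts pos ent ++ Snake.vertices rest)
              (Snake.lastEdge rest)
  where
    nextPos : Side → Pt
    nextPos sN = (proj₁ pos , suc (proj₂ pos))
    nextPos _  = (suc (proj₁ pos) , proj₂ pos)
    nextEnt : Side → Side
    nextEnt sN = sS
    nextEnt _  = sW
    rest = build (nextPos ex) (nextEnt ex) g gs

firstEdge : Edge
firstEdge = sideEdge (0 , 0) sS

snakeGraph : List Sign → Snake
snakeGraph []       = snake [] [] firstEdge
snakeGraph (f ∷ fs) = snake (firstEdge ∷ Snake.edges r)
                            ((0 , 0) ∷ (1 , 0) ∷ Snake.vertices r)
                            (Snake.lastEdge r)
  where r = build (0 , 0) sS f fs

subsets : {A : Set} → List A → List (List A)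
subsets []       = [] ∷ []
subsets (x ∷ xs) = let r = subsets xs in map (x ∷_) r ++ r

elemᵉ : Edge → List Edge → Bool
elemᵉ e = foldr (λ e' b → (e ==ᵉ e') ∨ b) false

incident : Pt → Edge → Bool
incident w (a , b) = (w ==ᵖ a) ∨ (w ==ᵖ b)

isPerfectMatching : List Pt → List Edge → Bool
isPerfectMatching vs M =
  foldr (λ w b → (length (filter (λ e → T? (incident w e)) M) ≡ᵇ 1) ∧ b) true vs

-- number of good matchings of the band graph obtained from the snake graph
-- with sign sequence fs by gluing e_0 and e_d: perfect matchings of the
-- snake graph containing e_0 or e_d
goodMatchings : List Sign → ℕ
goodMatchings fs =
  length (filter (λ M → T? (isPerfectMatching (Snake.vertices G) M
                            ∧ (elemᵉ firstEdge M ∨ elemᵉ (Snake.lastEdge G) M)))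
                 (subsets (Snake.edges G)))
  where G = snakeGraph fs

-- m°_{p/q}: the closed curve on O_3 lifts to the segment (ε,ε)→(q+ε,p+ε),
-- which passes just to the left of (q,p).  Cut at its starting point, its
-- crossings are those of δ for (2q,2p) up to and including the half-circle
-- around (q,p); the sign of the glued edge e_0 = e_d is the sign of the
-- common endpoint of the last crossed segment and the next one (the first
-- segment crossed again after the start point).

closedSigns : (q p : ℕ) → List Sign
closedSigns q p = c ∷ innerSigns (take n cs) ++ [ c ]
  where
    cs = Path.pathCrossings q p 2
    n  = length (Path.pathCrossings q p 1) + 3
    c : Sign
    c with drop (n ∸ 1) cs
    ... | a ∷ b ∷ _ = evenSign a b
    ... | _         = plus

mCirc : (q p : ℕ) → ℕ
mCirc q p = goodMatchings (closedSigns q p)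

{-# OPTIONS --safe #-}
module Submission where

-- Let + and - act by the matrices (1 0 ; 1 1) and (1 1 ; 0 1) of SL₂(ℤ), and a sign sequence W by
-- the product.  The continued fraction of (- W +) has as numerator the sum of the entries of W,
-- and the band graph of (+ W +), glued along a + edge, has tr (+ W) good matchings.  Up to
-- translation the path to (kq , kp) crosses the same segments between consecutive lattice points
-- and around each of them; if A and D = (+ - - - - - +) are the corresponding products, then
-- m_(kq,kp) is the sum of the entries of A (D A)^(k-1) and m° = tr (D A).  For k ≥ 3 the recurrence
-- is the Cayley-Hamilton theorem for D A, which has determinant 1; for k = 2 it also uses that the
-- entries of D⁻¹ sum to 0.

open import Defs
open import Data.Bool using (Bool; true; false; T; _∧_; _∨_; if_then_else_)
open import Data.Bool.Properties using (T?; ∧-zeroʳ; ∧-assoc; ∨-zeroʳ; ∨-identityʳ)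
open import Data.List using (List; []; _∷_; [_]; _++_; map; concatMap; filter; foldr; length; take; drop; applyUpTo)
open import Data.List.Properties using (foldr-cong; foldr-++; ++-assoc; map-++)
open import Data.List.Relation.Unary.All as All using (All; []; _∷_)
import Data.List.Relation.Unary.All.Properties as All
open import Data.Nat as ℕ using (ℕ; zero; suc; _+_; _∸_; _/_; _≤_; _<_; _≡ᵇ_; _<ᵇ_; z≤n; s≤s)
open import Data.Nat.Coprimality using (Coprime; coprime⇒gcd≡1)
open import Data.Nat.Divisibility using (_∣_; divides; ∣m+n∣m⇒∣n; ∣n⇒∣m*n; ∣1⇒≡1; ∣⇒≤; m%n≡0⇒n∣m)
open import Data.Nat.DivMod using (n/1≡n; m≡m%n+[m/n]*n; m*n/n≡m; +-distrib-/-∣ʳ; [m+kn]%n≡m%n; m<n⇒m/n≡0; m<n⇒m%n≡m)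
open import Data.Nat.GCD using (gcd; gcd[m,n]∣m; gcd[m,n]∣n; gcd-comm; gcd-greatest; c*gcd[m,n]≡gcd[cm,cn])
open import Data.Nat.Properties
open import Data.Nat.Solver using (module +-*-Solver)
open import Data.Product using (_×_; _,_; proj₁; proj₂; ∃₂)
open import Data.Sum using (_⊎_; inj₁; inj₂)
open import Data.Unit using (⊤)
open import Function using (_∘_; const; id)
open import Relation.Binary.PropositionalEquality
  using (_≡_; _≢_; refl; sym; trans; cong; cong₂; subst; module ≡-Reasoning)
open import Relation.Nullary using (¬_; contradiction)
open +-*-Solver using (solve; _:+_; _:*_; _:=_; con)

-- A fraction is kept as a pair whose order depends on the first sign of the sequence. Then
-- lengthening the first block and opening a new one are the same linear map, and gluing one more
-- tile to a snake graph acts on its matching counts by that map too; this is what ties both numbers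
-- to matrices.
--
-- The case k = 2 stands apart because m_(0,0) = 0 is a convention and not the value of a sign
-- sequence. Extended to k = 0, the formula A (D A)^(k-1) gives D⁻¹. Here D = (6 5 ; 7 6) and D⁻¹ =
-- (6 -5 ; -7 6), with entry sum 6 - 5 - 7 + 6 = 0, so the convention agrees with the formula.
--
-- Good matchings are defined by enumerating all sets of edges. Peeling off one tile therefore needs
-- to know which vertices it shares with the rest; coordinate bounds supply this, because a snake
-- graph only grows upwards and to the right. Recurrences are kept in ℕ with the subtracted term
-- moved across.

-- Signs as matrices, and continued fractions

module SignAction where
  open import Data.Nat using (_*_)

  act : Sign → ℕ × ℕ → ℕ × ℕ
  act plus  (x , y) = x , x + y
  act minus (x , y) = x + y , y

  run : List Sign → ℕ × ℕ → ℕ × ℕ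
  run ss v = foldr act v ss

  -- The representation of the fraction n / d, for a block list with first sign s, in which
  -- prepending a sign is linear.
  orient : Sign → ℕ × ℕ → ℕ × ℕ
  orient plus  (n , d) = d , n
  orient minus (n , d) = n , d

  -- The step of blocks, which is local to its definition.
  pushSign : Sign → List (Sign × ℕ) → List (Sign × ℕ)
  pushSign s [] = (s , 1) ∷ []
  pushSign s ((t , n) ∷ rest) =
    if s ==ˢ t then (t , suc n) ∷ rest else (s , 1) ∷ (t , n) ∷ rest

  blocks≡ : ∀ ss → blocks ss ≡ map proj₂ (foldr pushSign [] ss)
  blocks≡ ss = cong (map proj₂) (foldr-cong (λ { s [] → refl ; s (_ ∷ _) → refl }) refl ss)

  -- An equal sign turns n / d into (n + d) / d, a new block into 1 + d / n = (n + d) / n; after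
  -- `orient` both are `act`. The closing + alone is 1 / 1, hence the start vector (1 , 1). Exposing
  -- the first block lets `pushSign` reduce.
  cfFrac-blocks : ∀ s ss → ∃₂ λ n rest →
    foldr pushSign [] (s ∷ ss ++ [ plus ]) ≡ (s , n) ∷ rest ×
    orient s (cfFrac (n ∷ map proj₂ rest)) ≡ run (s ∷ ss) (1 , 1)
  cfFrac-blocks plus  [] = _ , _ , refl , refl
  cfFrac-blocks minus [] = _ , _ , refl , refl
  cfFrac-blocks s (t ∷ ss) with cfFrac-blocks t ss
  cfFrac-blocks plus (plus ∷ ss) | n , rest , eq , run≡ rewrite eq =
    suc n , rest , refl ,
    trans (cong₂ _,_ refl (+-assoc x (n * x) y)) (cong (act plus) run≡)
    where x = proj₁ (cfFrac (map proj₂ rest)) ; y = proj₂ (cfFrac (map proj₂ rest))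
  cfFrac-blocks plus (minus ∷ ss) | n , rest , eq , run≡ rewrite eq =
    1 , _ , refl , trans (cong₂ _,_ refl (cong (_+ x) (+-identityʳ _))) (cong (act plus) run≡)
    where x = proj₁ (cfFrac (map proj₂ rest))
  cfFrac-blocks minus (plus ∷ ss) | n , rest , eq , run≡ rewrite eq =
    1 , _ , refl ,
    trans (cong₂ _,_ (trans (cong (_+ x) (+-identityʳ _)) (+-comm (n * x + y) x)) refl)
          (cong (act minus) run≡)
    where x = proj₁ (cfFrac (map proj₂ rest)) ; y = proj₂ (cfFrac (map proj₂ rest))
  cfFrac-blocks minus (minus ∷ ss) | n , rest , eq , run≡ rewrite eq =
    suc n , rest , refl ,
    trans (cong₂ _,_ (trans (+-assoc x (n * x) y) (+-comm x (n * x + y))) refl)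
          (cong (act minus) run≡)
    where x = proj₁ (cfFrac (map proj₂ rest)) ; y = proj₂ (cfFrac (map proj₂ rest))

  -- Euclid's algorithm carries a common divisor down to `cfFrac []`, which is (1 , 0); so these
  -- fractions are already in lowest terms.
  cfFrac-∣1 : ∀ as {d} → d ∣ proj₁ (cfFrac as) → d ∣ proj₂ (cfFrac as) → d ∣ 1
  cfFrac-∣1 []       d∣n _   = d∣n
  cfFrac-∣1 (a ∷ as) d∣n d∣d = cfFrac-∣1 as d∣d (∣m+n∣m⇒∣n d∣n (∣n⇒∣m*n a d∣d))

  cfNumerator≡ : ∀ as → cfNumerator as ≡ proj₁ (cfFrac as)
  cfNumerator≡ as
    rewrite ∣1⇒≡1 (cfFrac-∣1 as (gcd[m,n]∣m _ (proj₂ (cfFrac as))) (gcd[m,n]∣n (proj₁ (cfFrac as)) _))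
    = n/1≡n _

  -- A leading - puts the numerator first. Its own action adds the two coordinates, which yields the
  -- sum of the entries of the matrix of `ss`.
  cfNumerator-run : ∀ ss → cfNumerator (blocks (minus ∷ ss ++ [ plus ])) ≡ proj₁ (run (minus ∷ ss) (1 , 1))
  cfNumerator-run ss with cfFrac-blocks minus ss
  ... | n , rest , eq , run≡ =
    trans (cfNumerator≡ (blocks (minus ∷ ss ++ [ plus ])))
          (trans (cong (λ as → proj₁ (cfFrac as)) (trans (blocks≡ (minus ∷ ss ++ [ plus ])) (cong (map proj₂) eq)))
          (cong proj₁ run≡))

  infixl 6 _⊞_
  infixl 7 _⊡_
  _⊞_ : ℕ × ℕ → ℕ × ℕ → ℕ × ℕ
  (x , y) ⊞ (x′ , y′) = x + x′ , y + y′
  _⊡_ : ℕ → ℕ × ℕ → ℕ × ℕ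
  t ⊡ (x , y) = t * x , t * y

  +-interchange : ∀ w x y z → (w + x) + (y + z) ≡ (w + y) + (x + z)
  +-interchange = solve 4 (λ w x y z → (w :+ x) :+ (y :+ z) := (w :+ y) :+ (x :+ z)) refl

  act-⊞ : ∀ s v w → act s (v ⊞ w) ≡ act s v ⊞ act s w
  act-⊞ plus  (x , y) (x′ , y′) = cong₂ _,_ refl (+-interchange x x′ y y′)
  act-⊞ minus (x , y) (x′ , y′) = cong₂ _,_ (+-interchange x x′ y y′) refl

  act-⊡ : ∀ s t v → act s (t ⊡ v) ≡ t ⊡ act s v
  act-⊡ plus  t (x , y) = cong₂ _,_ refl (sym (*-distribˡ-+ t x y))
  act-⊡ minus t (x , y) = cong₂ _,_ (sym (*-distribˡ-+ t x y)) refl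

  run-⊞ : ∀ ss v w → run ss (v ⊞ w) ≡ run ss v ⊞ run ss w
  run-⊞ []       v w = refl
  run-⊞ (s ∷ ss) v w = trans (cong (act s) (run-⊞ ss v w)) (act-⊞ s (run ss v) (run ss w))

  run-⊡ : ∀ ss t v → run ss (t ⊡ v) ≡ t ⊡ run ss v
  run-⊡ []       t v = refl
  run-⊡ (s ∷ ss) t v = trans (cong (act s) (run-⊡ ss t v)) (act-⊡ s t (run ss v))

  run-++ : ∀ ss ts v → run (ss ++ ts) v ≡ run ss (run ts v)
  run-++ ss ts v = foldr-++ act v ss ts

  e₁ e₂ : ℕ × ℕ
  e₁ = 1 , 0
  e₂ = 0 , 1

  module Entries (ss : List Sign) where
    a b c d : ℕ
    a = proj₁ (run ss e₁)
    b = proj₁ (run ss e₂)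
    c = proj₂ (run ss e₁)
    d = proj₂ (run ss e₂)

    run-entries : ∀ x y → run ss (x , y) ≡ (a * x + b * y , c * x + d * y)
    run-entries x y = begin
      run ss (x , y)                            ≡⟨ cong (run ss) (cong₂ _,_ x≡ y≡) ⟩
      run ss (x ⊡ e₁ ⊞ y ⊡ e₂)                  ≡⟨ run-⊞ ss _ _ ⟩
      run ss (x ⊡ e₁) ⊞ run ss (y ⊡ e₂)         ≡⟨ cong₂ _⊞_ (run-⊡ ss x e₁) (run-⊡ ss y e₂) ⟩
      x ⊡ run ss e₁ ⊞ y ⊡ run ss e₂             ≡⟨ cong₂ _,_ (cong₂ _+_ (*-comm x a) (*-comm y b)) (cong₂ _+_ (*-comm x c) (*-comm y d)) ⟩
      (a * x + b * y , c * x + d * y)           ∎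
      where
      open ≡-Reasoning
      x≡ : x ≡ x * 1 + y * 0
      x≡ = solve 2 (λ x y → x := x :* con 1 :+ y :* con 0) refl x y
      y≡ : y ≡ x * 0 + y * 1
      y≡ = solve 2 (λ x y → y := x :* con 0 :+ y :* con 1) refl x y

    trace : ℕ
    trace = a + d

  det≡1 : ∀ ss → let open Entries ss in a * d ≡ 1 + b * c
  det≡1 [] = refl
  det≡1 (plus ∷ ss) = begin
    a * (b + d)      ≡⟨ *-distribˡ-+ a b d ⟩
    a * b + a * d    ≡⟨ cong (a * b +_) (det≡1 ss) ⟩
    a * b + (1 + b * c) ≡⟨ solve 3 (λ a b c → a :* b :+ (con 1 :+ b :* c) := con 1 :+ b :* (a :+ c)) refl a b c ⟩
    1 + b * (a + c)  ∎
    where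
    open ≡-Reasoning
    open Entries ss
  det≡1 (minus ∷ ss) = begin
    (a + c) * d      ≡⟨ *-distribʳ-+ d a c ⟩
    a * d + c * d    ≡⟨ cong (_+ c * d) (det≡1 ss) ⟩
    1 + b * c + c * d ≡⟨ solve 3 (λ b c d → con 1 :+ b :* c :+ c :* d := con 1 :+ (b :+ d) :* c) refl b c d ⟩
    1 + (b + d) * c  ∎
    where
    open ≡-Reasoning
    open Entries ss

  -- This is M² - (tr M) M + I = 0 applied to a vector, with the negative term moved across.
  -- Determinant 1 enters by trading 1 + b c for a d.
  cayleyHamilton : ∀ ss v → run ss (run ss v) ⊞ v ≡ Entries.trace ss ⊡ run ss v
  cayleyHamilton ss (x , y) rewrite Entries.run-entries ss x y
    | Entries.run-entries ss (Entries.a ss * x + Entries.b ss * y) (Entries.c ss * x + Entries.d ss * y)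
    = cong₂ _,_ first second
    where
    open Entries ss
    open ≡-Reasoning
    first : a * (a * x + b * y) + b * (c * x + d * y) + x ≡ (a + d) * (a * x + b * y)
    first = begin
      a * (a * x + b * y) + b * (c * x + d * y) + x
        ≡⟨ solve 6 (λ a b c d x y → a :* (a :* x :+ b :* y) :+ b :* (c :* x :+ d :* y) :+ x
             := a :* (a :* x :+ b :* y) :+ d :* b :* y :+ (con 1 :+ b :* c) :* x) refl a b c d x y ⟩
      a * (a * x + b * y) + d * b * y + (1 + b * c) * x
        ≡⟨ cong (λ z → a * (a * x + b * y) + d * b * y + z * x) (sym (det≡1 ss)) ⟩
      a * (a * x + b * y) + d * b * y + a * d * x
        ≡⟨ solve 5 (λ a b d x y → a :* (a :* x :+ b :* y) :+ d :* b :* y :+ a :* d :* x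
             := (a :+ d) :* (a :* x :+ b :* y)) refl a b d x y ⟩
      (a + d) * (a * x + b * y) ∎
    second : c * (a * x + b * y) + d * (c * x + d * y) + y ≡ (a + d) * (c * x + d * y)
    second = begin
      c * (a * x + b * y) + d * (c * x + d * y) + y
        ≡⟨ solve 6 (λ a b c d x y → c :* (a :* x :+ b :* y) :+ d :* (c :* x :+ d :* y) :+ y
             := a :* c :* x :+ d :* (c :* x :+ d :* y) :+ (con 1 :+ b :* c) :* y) refl a b c d x y ⟩
      a * c * x + d * (c * x + d * y) + (1 + b * c) * y
        ≡⟨ cong (λ z → a * c * x + d * (c * x + d * y) + z * y) (sym (det≡1 ss)) ⟩
      a * c * x + d * (c * x + d * y) + a * d * y
        ≡⟨ solve 5 (λ a c d x y → a :* c :* x :+ d :* (c :* x :+ d :* y) :+ a :* d :* y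
             := (a :+ d) :* (c :* x :+ d :* y)) refl a c d x y ⟩
      (a + d) * (c * x + d * y) ∎

open SignAction

-- Counting edge sets by recursion on the edge list

Predᵇ : Set
Predᵇ = List Edge → Bool

-- Taking an edge becomes precomposition of the predicate, so the edges of one tile can be decided
-- before the others are looked at.
countSubsets : Predᵇ → List Edge → ℕ
countSubsets P []       = if P [] then 1 else 0
countSubsets P (e ∷ es) = countSubsets (P ∘ (e ∷_)) es + countSubsets P es

countᵇ : Predᵇ → List (List Edge) → ℕ
countᵇ P = length ∘ filter (T? ∘ P)

countᵇ-++ : ∀ P xs ys → countᵇ P (xs ++ ys) ≡ countᵇ P xs + countᵇ P ys
countᵇ-++ P []       ys = refl
countᵇ-++ P (x ∷ xs) ys with P x
... | true  = cong suc (countᵇ-++ P xs ys)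
... | false = countᵇ-++ P xs ys

countᵇ-map : ∀ P f xs → countᵇ P (map f xs) ≡ countᵇ (P ∘ f) xs
countᵇ-map P f []       = refl
countᵇ-map P f (x ∷ xs) with P (f x)
... | true  = cong suc (countᵇ-map P f xs)
... | false = countᵇ-map P f xs

countᵇ-subsets : ∀ P es → countᵇ P (subsets es) ≡ countSubsets P es
countᵇ-subsets P [] with P []
... | true  = refl
... | false = refl
countᵇ-subsets P (e ∷ es) =
  trans (countᵇ-++ P (map (e ∷_) (subsets es)) (subsets es))
        (cong₂ _+_ (trans (countᵇ-map P (e ∷_) (subsets es)) (countᵇ-subsets (P ∘ (e ∷_)) es))
                   (countᵇ-subsets P es))

-- The predicates need to agree only on sets of listed edges; `Good` carries what is known about
-- those edges, such as which vertices they avoid.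
countSubsets-cong : ∀ {Good : Edge → Set} {P Q : Predᵇ} {es} → All Good es →
  (∀ M → All Good M → P M ≡ Q M) → countSubsets P es ≡ countSubsets Q es
countSubsets-cong []         P≡Q = cong (if_then 1 else 0) (P≡Q [] [])
countSubsets-cong (ge ∷ ges) P≡Q = cong₂ _+_
  (countSubsets-cong ges (λ M gM → P≡Q _ (ge ∷ gM)))
  (countSubsets-cong ges P≡Q)

countSubsets-false : ∀ es → countSubsets (const false) es ≡ 0
countSubsets-false []       = refl
countSubsets-false (e ∷ es) = cong₂ _+_ (countSubsets-false es) (countSubsets-false es)

deg : Pt → List Edge → ℕ
deg w M = length (filter (λ e → T? (incident w e)) M)

≢⇒==ᵖ : ∀ v w → v ≢ w → (v ==ᵖ w) ≡ false
≢⇒==ᵖ (x , y) (x′ , y′) v≢w with x ≡ᵇ x′ in eqx | y ≡ᵇ y′ in eqy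
... | false | _     = refl
... | true  | false = refl
... | true  | true  = contradiction
  (cong₂ _,_ (≡ᵇ⇒≡ x x′ (subst T (sym eqx) _)) (≡ᵇ⇒≡ y y′ (subst T (sym eqy) _))) v≢w

≡ᵇ-refl : ∀ n → (n ≡ᵇ n) ≡ true
≡ᵇ-refl zero    = refl
≡ᵇ-refl (suc n) = ≡ᵇ-refl n

==ᵖ-refl : ∀ v → (v ==ᵖ v) ≡ true
==ᵖ-refl (x , y) rewrite ≡ᵇ-refl x | ≡ᵇ-refl y = refl

Avoids : Pt → Edge → Set
Avoids w e = w ≢ proj₁ e × w ≢ proj₂ e

Avoids⇒incident : ∀ w e → Avoids w e → incident w e ≡ false
Avoids⇒incident w (v , v′) (w≢v , w≢v′) rewrite ≢⇒==ᵖ w v w≢v | ≢⇒==ᵖ w v′ w≢v′ = refl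

incident-left : ∀ w v → incident w (w , v) ≡ true
incident-left w v rewrite ==ᵖ-refl w = refl

incident-right : ∀ w v → incident w (v , w) ≡ true
incident-right w v rewrite ==ᵖ-refl w = ∨-zeroʳ _

≢₁⇒==ᵉ : ∀ e e′ → proj₁ e ≢ proj₁ e′ → (e ==ᵉ e′) ≡ false
≢₁⇒==ᵉ (v , w) (v′ , w′) v≢v′ rewrite ≢⇒==ᵖ v v′ v≢v′ = refl

≢₂⇒==ᵉ : ∀ e e′ → proj₂ e ≢ proj₂ e′ → (e ==ᵉ e′) ≡ false
≢₂⇒==ᵉ (v , w) (v′ , w′) w≢w′ rewrite ≢⇒==ᵖ w w′ w≢w′ = ∧-zeroʳ _

==ᵉ-refl : ∀ e → (e ==ᵉ e) ≡ true
==ᵉ-refl (v , w) rewrite ==ᵖ-refl v | ==ᵖ-refl w = refl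

deg-∷-avoid : ∀ w e M → Avoids w e → deg w (e ∷ M) ≡ deg w M
deg-∷-avoid w e M av rewrite Avoids⇒incident w e av = refl

deg-avoid : ∀ w M → All (Avoids w) M → deg w M ≡ 0
deg-avoid w []      []         = refl
deg-avoid w (e ∷ M) (av ∷ avs) = trans (deg-∷-avoid w e M av) (deg-avoid w M avs)

isPM-∷-avoid : ∀ V e M → All (λ w → Avoids w e) V →
  isPerfectMatching V (e ∷ M) ≡ isPerfectMatching V M
isPM-∷-avoid []      e M []         = refl
isPM-∷-avoid (w ∷ V) e M (av ∷ avs) =
  cong₂ _∧_ (cong (_≡ᵇ 1) (deg-∷-avoid w e M av)) (isPM-∷-avoid V e M avs)

bit : Bool → ℕ
bit true  = 1
bit false = 0

opt : Bool → Edge → List Edge → List Edge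
opt true  e M = e ∷ M
opt false e M = M

deg-opt-left : ∀ p v w M → deg v (opt p (v , w) M) ≡ bit p + deg v M
deg-opt-left false v w M = refl
deg-opt-left true  v w M rewrite incident-left v w = refl

deg-opt-right : ∀ p v w M → deg w (opt p (v , w) M) ≡ bit p + deg w M
deg-opt-right false v w M = refl
deg-opt-right true  v w M rewrite incident-right w v = refl

deg-opt-avoid : ∀ p w e M → Avoids w e → deg w (opt p e M) ≡ deg w M
deg-opt-avoid false w e M av = refl
deg-opt-avoid true  w e M av = deg-∷-avoid w e M av

isPM-opt-avoid : ∀ p V e M → All (λ w → Avoids w e) V →
  isPerfectMatching V (opt p e M) ≡ isPerfectMatching V M
isPM-opt-avoid false V e M av = refl
isPM-opt-avoid true  V e M av = isPM-∷-avoid V e M av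

elem-opt-≢ : ∀ p e e′ M → (e ==ᵉ e′) ≡ false → elemᵉ e (opt p e′ M) ≡ elemᵉ e M
elem-opt-≢ false e e′ M ne = refl
elem-opt-≢ true  e e′ M ne rewrite ne = refl

elem-opt-≡ : ∀ p e M → elemᵉ e (opt p e M) ≡ p ∨ elemᵉ e M
elem-opt-≡ false e M = refl
elem-opt-≡ true  e M rewrite ==ᵉ-refl e = refl

-- Transfer of matching counts across one tile

-- The bracketing is the one that `countSubsets` unfolds to on three edges, so one of the two edge
-- orders needs no proof.
sum₈ : (Bool → Bool → Bool → ℕ) → ℕ
sum₈ f = ((f true  true true + f true  true false) + (f true  false true + f true  false false))
       + ((f false true true + f false true false) + (f false false true + f false false false))

sum₈-cong : ∀ {f g} → (∀ p q r → f p q r ≡ g p q r) → sum₈ f ≡ sum₈ g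
sum₈-cong eq = cong₂ _+_
  (cong₂ _+_ (cong₂ _+_ (eq _ _ _) (eq _ _ _)) (cong₂ _+_ (eq _ _ _) (eq _ _ _)))
  (cong₂ _+_ (cong₂ _+_ (eq _ _ _) (eq _ _ _)) (cong₂ _+_ (eq _ _ _) (eq _ _ _)))

sum₈-rotate : ∀ f → sum₈ (λ q r p → f p q r) ≡ sum₈ f
sum₈-rotate f = solve 8 (λ s t u v w x y z →
    ((s :+ w) :+ (t :+ x)) :+ ((u :+ y) :+ (v :+ z)) :=
    ((s :+ t) :+ (u :+ v)) :+ ((w :+ x) :+ (y :+ z))) refl
  (f true true true) (f true true false) (f true false true) (f true false false)
  (f false true true) (f false true false) (f false false true) (f false false false)

-- h is const true to count all matchings and id to count those that use the last edge.
StatePred : (Bool → Bool) → Pt → Pt → Snake → ℕ → ℕ → Predᵇ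
StatePred h a b R i j M =
  (deg a M ≡ᵇ i) ∧ (deg b M ≡ᵇ j) ∧ isPerfectMatching (Snake.vertices R) M
    ∧ h (elemᵉ (Snake.lastEdge R) M)

matchCount : (Bool → Bool) → Pt → Pt → Snake → ℕ → ℕ → ℕ
matchCount h a b R i j = countSubsets (StatePred h a b R i j) (Snake.edges R)

-- Each tile adds two vertices, so by parity no set covers all of them and exactly one of a and b.
-- These two zeros are carried along because the counts of a longer snake refer to them.
record MatchCounts (h : Bool → Bool) (a b : Pt) (R : Snake) (x y : ℕ) : Set where
  constructor counts
  field
    both-free    : matchCount h a b R 0 0 ≡ x
    both-matched : matchCount h a b R 1 1 ≡ y
    mixed₀₁      : matchCount h a b R 0 1 ≡ 0
    mixed₁₀      : matchCount h a b R 1 0 ≡ 0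

open MatchCounts

record Distinct (a b c d : Pt) : Set where
  field
    a≢b : a ≢ b
    a≢c : a ≢ c
    a≢d : a ≢ d
    b≢c : b ≢ c
    b≢d : b ≢ d
    c≢d : c ≢ d

-- A tile entered through ab that can be left through the opposite edge cd or the adjacent edge bd;
-- the two constructors are the orders of otherSides sS and otherSides sW.
data TileEdges (a b c d : Pt) : List Edge → Set where
  enterS : TileEdges a b c d ((c , d) ∷ (a , c) ∷ (b , d) ∷ [])
  enterW : TileEdges a b c d ((a , c) ∷ (b , d) ∷ (c , d) ∷ [])

choose : ∀ {a b c d es} → TileEdges a b c d es → Bool → Bool → Bool → List Edge → List Edge
choose {a} {b} {c} {d} enterS p q r M = opt p (c , d) (opt q (a , c) (opt r (b , d) M))
choose {a} {b} {c} {d} enterW p q r M = opt q (a , c) (opt r (b , d) (opt p (c , d) M))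

countSubsets-tile : ∀ {a b c d es} (te : TileEdges a b c d es) P fs →
  countSubsets P (es ++ fs) ≡ sum₈ (λ p q r → countSubsets (P ∘ choose te p q r) fs)
countSubsets-tile enterS P fs = refl
countSubsets-tile te@enterW P fs = sum₈-rotate (λ p q r → countSubsets (P ∘ choose te p q r) fs)

-- Every edge of the tile has c or d as its second endpoint, so comparing second endpoints is enough
-- to tell the last edge apart from all three.
module TileStep (h : Bool → Bool) {a b c d : Pt} (dist : Distinct a b c d) (R : Snake)
  (V-far : All (λ w → All (w ≢_) (a ∷ b ∷ c ∷ d ∷ [])) (Snake.vertices R))
  (last-far : All (proj₂ (Snake.lastEdge R) ≢_) (c ∷ d ∷ []))
  where
  open Snake R
  open Distinct dist

  -- The effect of the chosen tile edges, stated without their order in the list, so that both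
  -- entering sides share the arguments below.
  record Split (p q r : Bool) (M N : List Edge) : Set where
    field
      deg-a : deg a N ≡ bit q + deg a M
      deg-b : deg b N ≡ bit r + deg b M
      deg-c : deg c N ≡ bit p + (bit q + deg c M)
      deg-d : deg d N ≡ bit p + (bit r + deg d M)
      isPM-vertices : isPerfectMatching vertices N ≡ isPerfectMatching vertices M
      elem-last : elemᵉ lastEdge N ≡ elemᵉ lastEdge M

  V-cd : All (λ w → Avoids w (c , d)) vertices
  V-cd = All.map (λ { (_ ∷ _ ∷ w≢c ∷ w≢d ∷ []) → w≢c , w≢d }) V-far

  V-ac : All (λ w → Avoids w (a , c)) vertices
  V-ac = All.map (λ { (w≢a ∷ _ ∷ w≢c ∷ _ ∷ []) → w≢a , w≢c }) V-far

  V-bd : All (λ w → Avoids w (b , d)) vertices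
  V-bd = All.map (λ { (_ ∷ w≢b ∷ _ ∷ w≢d ∷ []) → w≢b , w≢d }) V-far

  last≢ac : (lastEdge ==ᵉ (a , c)) ≡ false
  last≢ac = ≢₂⇒==ᵉ lastEdge (a , c) (All.head last-far)

  last≢-d : ∀ v → (lastEdge ==ᵉ (v , d)) ≡ false
  last≢-d v = ≢₂⇒==ᵉ lastEdge (v , d) (All.head (All.tail last-far))

  split : ∀ {es} (te : TileEdges a b c d es) p q r M → Split p q r M (choose te p q r M)
  split enterS p q r M = record
    { deg-a = trans (deg-opt-avoid p a _ _ (a≢c , a≢d))
             (trans (deg-opt-left q a c _)
                    (cong (bit q +_) (deg-opt-avoid r a _ M (a≢b , a≢d))))
    ; deg-b = trans (deg-opt-avoid p b _ _ (b≢c , b≢d))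
             (trans (deg-opt-avoid q b _ _ (a≢b ∘ sym , b≢c))
                    (deg-opt-left r b d M))
    ; deg-c = trans (deg-opt-left p c d _) (cong (bit p +_)
             (trans (deg-opt-right q a c _)
                    (cong (bit q +_) (deg-opt-avoid r c _ M (b≢c ∘ sym , c≢d)))))
    ; deg-d = trans (deg-opt-right p c d _) (cong (bit p +_)
             (trans (deg-opt-avoid q d _ _ (a≢d ∘ sym , c≢d ∘ sym))
                    (deg-opt-right r b d M)))
    ; isPM-vertices = trans (isPM-opt-avoid p vertices _ _ V-cd)
                     (trans (isPM-opt-avoid q vertices _ _ V-ac) (isPM-opt-avoid r vertices _ M V-bd))
    ; elem-last = trans (elem-opt-≢ p lastEdge _ _ (last≢-d _))
                 (trans (elem-opt-≢ q lastEdge _ _ last≢ac) (elem-opt-≢ r lastEdge _ M (last≢-d _)))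
    }

  split enterW p q r M = record
    { deg-a = trans (deg-opt-left q a c _)
             (cong (bit q +_) (trans (deg-opt-avoid r a _ _ (a≢b , a≢d))
                                     (deg-opt-avoid p a _ M (a≢c , a≢d))))
    ; deg-b = trans (deg-opt-avoid q b _ _ (a≢b ∘ sym , b≢c))
             (trans (deg-opt-left r b d _)
                    (cong (bit r +_) (deg-opt-avoid p b _ M (b≢c , b≢d))))
    ; deg-c = trans (deg-opt-right q a c _)
             (trans (cong (bit q +_) (trans (deg-opt-avoid r c _ _ (b≢c ∘ sym , c≢d))
                                            (deg-opt-left p c d M)))
                    (swap (bit q) (bit p) (deg c M)))
    ; deg-d = trans (deg-opt-avoid q d _ _ (a≢d ∘ sym , c≢d ∘ sym))
             (trans (deg-opt-right r b d _)
             (trans (cong (bit r +_) (deg-opt-right p c d M))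
                    (swap (bit r) (bit p) (deg d M))))
    ; isPM-vertices = trans (isPM-opt-avoid q vertices _ _ V-ac)
                     (trans (isPM-opt-avoid r vertices _ _ V-bd) (isPM-opt-avoid p vertices _ M V-cd))
    ; elem-last = trans (elem-opt-≢ q lastEdge _ _ last≢ac)
                 (trans (elem-opt-≢ r lastEdge _ _ (last≢-d _)) (elem-opt-≢ p lastEdge _ M (last≢-d _)))
    }
    where
    swap : ∀ x y z → x + (y + z) ≡ y + (x + z)
    swap x y z = trans (sym (+-assoc x y z)) (trans (cong (_+ z) (+-comm x y)) (+-assoc y x z))

  extended : List Edge → Snake
  extended es = snake (es ++ edges) (c ∷ d ∷ vertices) lastEdge

  module _ {Good : Edge → Set} (good : All Good edges) (i j : ℕ)
    (T : Bool → Bool → Bool → Predᵇ)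
    (pointwise : ∀ {p q r M N} → All Good M → Split p q r M N →
                 StatePred h a b (extended []) i j N ≡ T p q r M)
    where

    expand : ∀ {es} → TileEdges a b c d es →
      matchCount h a b (extended es) i j ≡ sum₈ (λ p q r → countSubsets (T p q r) edges)
    expand {es} te = trans (countSubsets-tile te SP edges)
      (sum₈-cong {f = λ p q r → countSubsets (SP ∘ choose te p q r) edges}
        (λ p q r → countSubsets-cong good (λ M gM → pointwise gM (split te p q r M))))
      where SP = StatePred h a b (extended es) i j

  -- A false condition behind an undecided one does not reduce by itself; this disposes of such
  -- terms.
  vanish : ∀ (B : Predᵇ) → countSubsets (λ M → B M ∧ false) edges ≡ 0
  vanish B = trans (countSubsets-cong {Good = const ⊤} (All.universal _ edges) (λ M _ → ∧-zeroʳ (B M)))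
                   (countSubsets-false edges)

  module Straight (good : All (λ e → Avoids a e × Avoids b e) edges) where

    T-straight : ℕ → ℕ → Bool → Bool → Bool → Predᵇ
    T-straight i j p q r M =
      (bit q ≡ᵇ i) ∧ (bit r ≡ᵇ j) ∧ (bit p + (bit q + deg c M) ≡ᵇ 1) ∧ (bit p + (bit r + deg d M) ≡ᵇ 1)
      ∧ isPerfectMatching vertices M ∧ h (elemᵉ lastEdge M)

    pointwise : ∀ i j {p q r M N} → All (λ e → Avoids a e × Avoids b e) M → Split p q r M N →
                 StatePred h a b (extended []) i j N ≡ T-straight i j p q r M
    pointwise i j {p} {q} {r} {M} {N} gM sp
      rewrite Split.deg-a sp | Split.deg-b sp | Split.deg-c sp | Split.deg-d sp
        | Split.isPM-vertices sp | Split.elem-last sp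
        | deg-avoid a M (All.map proj₁ gM) | deg-avoid b M (All.map proj₂ gM)
        | +-identityʳ (bit q) | +-identityʳ (bit r)
      = cong (λ z → (bit q ≡ᵇ i) ∧ (bit r ≡ᵇ j) ∧ z)
          (trans (∧-assoc (bit p + (bit q + deg c M) ≡ᵇ 1) _ _)
                 (cong ((bit p + (bit q + deg c M) ≡ᵇ 1) ∧_) (∧-assoc (bit p + (bit r + deg d M) ≡ᵇ 1) _ _)))

    -- If a and b stay free, c and d are matched by the edge cd or both inside `R`: x + y. If they
    -- are matched, by ac and bd, then c and d are used up and must stay free in `R`: x.
    straight : ∀ {es x y} → TileEdges a b c d es → MatchCounts h c d R x y →
               MatchCounts h a b (extended es) (x + y) x
    straight {es} {x} {y} te (counts free matched m₀₁ m₁₀) = counts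
      (trans (expand′ 0 0) eval₀₀) (trans (expand′ 1 1) eval₁₁)
      (trans (expand′ 0 1) eval₀₁) (trans (expand′ 1 0) eval₁₀)
      where
      expand′ : ∀ i j → _
      expand′ i j = expand good i j (T-straight i j) (λ {p} {q} {r} {M} {N} → pointwise i j {p} {q} {r} {M} {N}) te
      total : ℕ → ℕ → ℕ
      total i j = sum₈ (λ p q r → countSubsets (T-straight i j p q r) edges)
      eval₀₀ : total 0 0 ≡ x + y
      eval₀₀ rewrite countSubsets-false edges | free | matched = refl
      eval₁₁ : total 1 1 ≡ x
      eval₁₁ rewrite countSubsets-false edges | free = trans (+-identityʳ _) (+-identityʳ _)
      eval₀₁ : total 0 1 ≡ 0
      eval₀₁ rewrite countSubsets-false edges | vanish (λ M → deg c M ≡ᵇ 0) | m₁₀ = refl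
      eval₁₀ : total 1 0 ≡ 0
      eval₁₀ rewrite countSubsets-false edges | m₀₁ = refl

  module Turn (good : All (λ e → Avoids a e × Avoids c e) edges) where

    T-turn : ℕ → ℕ → Bool → Bool → Bool → Predᵇ
    T-turn i j p q r M =
      (bit q ≡ᵇ i) ∧ (bit p + bit q ≡ᵇ 1) ∧ (bit r + deg b M ≡ᵇ j) ∧ (bit p + (bit r + deg d M) ≡ᵇ 1)
      ∧ isPerfectMatching vertices M ∧ h (elemᵉ lastEdge M)

    -- The condition at c depends on p and q alone; placed before the undecided one at b, it removes
    -- impossible terms by evaluation.
    ∧-shuffle : ∀ s t u v w → s ∧ (t ∧ u ∧ v) ∧ w ≡ t ∧ s ∧ u ∧ v ∧ w
    ∧-shuffle true  true  u v w = ∧-assoc u v w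
    ∧-shuffle true  false u v w = refl
    ∧-shuffle false true  u v w = refl
    ∧-shuffle false false u v w = refl

    pointwise : ∀ i j {p q r M N} → All (λ e → Avoids a e × Avoids c e) M → Split p q r M N →
                 StatePred h a b (extended []) i j N ≡ T-turn i j p q r M
    pointwise i j {p} {q} {r} {M} {N} gM sp
      rewrite Split.deg-a sp | Split.deg-b sp | Split.deg-c sp | Split.deg-d sp
        | Split.isPM-vertices sp | Split.elem-last sp
        | deg-avoid a M (All.map proj₁ gM) | deg-avoid c M (All.map proj₂ gM)
        | +-identityʳ (bit q)
      = cong ((bit q ≡ᵇ i) ∧_) 
          (∧-shuffle (bit r + deg b M ≡ᵇ j) (bit p + bit q ≡ᵇ 1) (bit p + (bit r + deg d M) ≡ᵇ 1) _ _)

    -- The vertex c is matched by cd or ac. If a stays free it is cd, which uses d and forces b and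
    -- d free in `R`: x. If a is matched it is ac, and b and d are matched by bd or both inside `R`:
    -- x + y.
    turn : ∀ {es x y} → TileEdges a b c d es → MatchCounts h b d R x y →
           MatchCounts h a b (extended es) x (x + y)
    turn {es} {x} {y} te (counts free matched m₀₁ m₁₀) = counts
      (trans (expand′ 0 0) eval₀₀) (trans (expand′ 1 1) eval₁₁)
      (trans (expand′ 0 1) eval₀₁) (trans (expand′ 1 0) eval₁₀)
      where
      expand′ : ∀ i j → _
      expand′ i j = expand good i j (T-turn i j) (λ {p} {q} {r} {M} {N} → pointwise i j {p} {q} {r} {M} {N}) te
      total : ℕ → ℕ → ℕ
      total i j = sum₈ (λ p q r → countSubsets (T-turn i j p q r) edges)
      eval₀₀ : total 0 0 ≡ x
      eval₀₀ rewrite countSubsets-false edges | free = +-identityʳ _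
      eval₁₁ : total 1 1 ≡ x + y
      eval₁₁ rewrite countSubsets-false edges | free | matched = +-identityʳ _
      eval₀₁ : total 0 1 ≡ 0
      eval₀₁ rewrite countSubsets-false edges | vanish (λ M → deg b M ≡ᵇ 0) | m₁₀ = refl
      eval₁₀ : total 1 0 ≡ 0
      eval₁₀ rewrite countSubsets-false edges | m₀₁ = refl

-- Where the vertices of a snake graph lie

infix 4 _⊑_
_⊑_ : Pt → Pt → Set
(x , y) ⊑ (x′ , y′) = x ≤ x′ × y ≤ y′

⊑-refl : ∀ {v} → v ⊑ v
⊑-refl = ≤-refl , ≤-refl

⊑-stepˣ : ∀ {x y w} → (suc x , y) ⊑ w → (x , y) ⊑ w
⊑-stepˣ (p , q) = <⇒≤ p , q

⊑-stepʸ : ∀ {x y w} → (x , suc y) ⊑ w → (x , y) ⊑ w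
⊑-stepʸ (p , q) = p , <⇒≤ q

-- Where the vertices off the entering edge of the snake graph that starts at a tile can lie.
Fresh : Pt → Side → Pt → Set
Fresh (x , y) sW w = (suc x , y) ⊑ w ⊎ (x , 2 + y) ⊑ w
Fresh (x , y) _  w = (x , suc y) ⊑ w ⊎ (2 + x , y) ⊑ w

Outside : Pt → Pt → Set
Outside (x , y) (wx , wy) = 2 + x ≤ wx ⊎ 2 + y ≤ wy

-- Edges point right or up, so a first endpoint may still lie on the entering edge while the second
-- endpoint is always new.
record Located (pos : Pt) (ent : Side) (R : Snake) : Set where
  constructor located
  open Snake R
  field
    verts-fresh : All (Fresh pos ent) vertices
    edges-fresh : All (λ e → pos ⊑ proj₁ e × Fresh pos ent (proj₂ e)) edges
    last-fresh  : Fresh pos ent (proj₂ lastEdge)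

beyondˣ : {w v : Pt} → proj₁ v < proj₁ w → w ≢ v
beyondˣ v<w refl = <-irrefl refl v<w

beyondʸ : {w v : Pt} → proj₂ v < proj₂ w → w ≢ v
beyondʸ v<w refl = <-irrefl refl v<w

outside⇒≢ : ∀ {x y vx vy w} → vx ≤ suc x → vy ≤ suc y → Outside (x , y) w → w ≢ (vx , vy)
outside⇒≢ p q (inj₁ r) = beyondˣ (≤-trans (s≤s p) r)
outside⇒≢ p q (inj₂ r) = beyondʸ (≤-trans (s≤s q) r)

StateCounts : (Bool → Bool) → Pt → Side → Snake → ℕ → ℕ → Set
StateCounts h pos ent R = MatchCounts h (proj₁ (sideEdge pos ent)) (proj₂ (sideEdge pos ent)) R

module Tile (x y : ℕ) where
  sw se nw ne : Pt
  sw = x , y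
  se = suc x , y
  nw = x , suc y
  ne = suc x , suc y

  distinctS : Distinct sw se nw ne
  distinctS = record
    { a≢b = beyondˣ (n<1+n x) ∘ sym ; a≢c = beyondʸ (n<1+n y) ∘ sym ; a≢d = beyondˣ (n<1+n x) ∘ sym
    ; b≢c = beyondˣ (n<1+n x) ; b≢d = beyondʸ (n<1+n y) ∘ sym ; c≢d = beyondˣ (n<1+n x) ∘ sym }

  -- Reflection in the diagonal exchanges `se` and `nw` and turns entry from the south into entry
  -- from the west.
  distinctW : Distinct sw nw se ne
  distinctW = record
    { a≢b = a≢c ; a≢c = a≢b ; a≢d = a≢d ; b≢c = b≢c ∘ sym ; b≢d = c≢d ; c≢d = b≢d }
    where open Distinct distinctS

  tileS tileW : Snake → Snake
  tileS (snake es vs l) = snake (map (sideEdge sw) (otherSides sS) ++ es) (newVerts sw sS ++ vs) l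
  tileW (snake es vs l) = snake (map (sideEdge sw) (otherSides sW) ++ es) (newVerts sw sW ++ vs) l

  outside-N : ∀ {w} → Fresh nw sS w → Outside sw w
  outside-N (inj₁ (_ , q)) = inj₂ q
  outside-N (inj₂ (p , _)) = inj₁ p

  outside-E : ∀ {w} → Fresh se sW w → Outside sw w
  outside-E (inj₁ (p , _)) = inj₁ p
  outside-E (inj₂ (_ , q)) = inj₂ q

  ≢sw : ∀ {w} → Outside sw w → w ≢ sw
  ≢sw = outside⇒≢ (n≤1+n x) (n≤1+n y)
  ≢se : ∀ {w} → Outside sw w → w ≢ se
  ≢se = outside⇒≢ ≤-refl (n≤1+n y)
  ≢nw : ∀ {w} → Outside sw w → w ≢ nw
  ≢nw = outside⇒≢ (n≤1+n x) ≤-refl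
  ≢ne : ∀ {w} → Outside sw w → w ≢ ne
  ≢ne = outside⇒≢ ≤-refl ≤-refl

  farS : ∀ {w} → Outside sw w → All (w ≢_) (sw ∷ se ∷ nw ∷ ne ∷ [])
  farS o = ≢sw o ∷ ≢se o ∷ ≢nw o ∷ ≢ne o ∷ []

  farW : ∀ {w} → Outside sw w → All (w ≢_) (sw ∷ nw ∷ se ∷ ne ∷ [])
  farW o = ≢sw o ∷ ≢nw o ∷ ≢se o ∷ ≢ne o ∷ []

  avoid-below : ∀ {e vx} → vx ≤ suc x → nw ⊑ proj₁ e × Fresh nw sS (proj₂ e) → Avoids (vx , y) e
  avoid-below vx≤ ((_ , q) , f) = beyondʸ q ∘ sym , outside⇒≢ vx≤ (n≤1+n y) (outside-N f) ∘ sym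

  avoid-left : ∀ {e vy} → vy ≤ suc y → se ⊑ proj₁ e × Fresh se sW (proj₂ e) → Avoids (x , vy) e
  avoid-left vy≤ ((p , _) , f) = beyondˣ p ∘ sym , outside⇒≢ (n≤1+n x) vy≤ (outside-E f) ∘ sym

  module _ {h : Bool → Bool} {R : Snake} {u v : ℕ} where

    straightS : Located nw sS R → StateCounts h nw sS R u v → StateCounts h sw sS (tileS R) (u + v) u
    straightS (located vf ef lf) = Straight.straight
      (All.map (λ e → avoid-below (n≤1+n x) e , avoid-below ≤-refl e) ef) enterS
      where open TileStep h distinctS R (All.map (farS ∘ outside-N) vf) (All.tail (All.tail (farS (outside-N lf))))

    turnS : Located se sW R → StateCounts h se sW R u v → StateCounts h sw sS (tileS R) u (u + v)
    turnS (located vf ef lf) = Turn.turn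
      (All.map (λ e → avoid-left (n≤1+n y) e , avoid-left ≤-refl e) ef) enterS
      where open TileStep h distinctS R (All.map (farS ∘ outside-E) vf) (All.tail (All.tail (farS (outside-E lf))))

    straightW : Located se sW R → StateCounts h se sW R u v → StateCounts h sw sW (tileW R) (u + v) u
    straightW (located vf ef lf) = Straight.straight
      (All.map (λ e → avoid-left (n≤1+n y) e , avoid-left ≤-refl e) ef) enterW
      where open TileStep h distinctW R (All.map (farW ∘ outside-E) vf) (All.tail (All.tail (farW (outside-E lf))))

    turnW : Located nw sS R → StateCounts h nw sS R u v → StateCounts h sw sW (tileW R) u (u + v)
    turnW (located vf ef lf) = Turn.turn
      (All.map (λ e → avoid-below (n≤1+n x) e , avoid-below ≤-refl e) ef) enterW
      where open TileStep h distinctW R (All.map (farW ∘ outside-N) vf) (All.tail (All.tail (farW (outside-N lf))))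

  fresh-NS : ∀ {w} → Fresh nw sS w → Fresh sw sS w
  fresh-NS (inj₁ p) = inj₁ (⊑-stepʸ p)
  fresh-NS (inj₂ p) = inj₂ (⊑-stepʸ p)

  fresh-ES : ∀ {w} → Fresh se sW w → Fresh sw sS w
  fresh-ES (inj₁ p) = inj₂ p
  fresh-ES (inj₂ p) = inj₁ (⊑-stepˣ (⊑-stepʸ p))

  fresh-EW : ∀ {w} → Fresh se sW w → Fresh sw sW w
  fresh-EW (inj₁ p) = inj₁ (⊑-stepˣ p)
  fresh-EW (inj₂ p) = inj₂ (⊑-stepˣ p)

  fresh-NW : ∀ {w} → Fresh nw sS w → Fresh sw sW w
  fresh-NW (inj₁ p) = inj₂ p
  fresh-NW (inj₂ p) = inj₁ (⊑-stepʸ (⊑-stepˣ p))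

  located-tileS : ∀ {vs es l} → All (Fresh sw sS) vs →
    All (λ e → sw ⊑ proj₁ e × Fresh sw sS (proj₂ e)) es → Fresh sw sS (proj₂ l) →
    Located sw sS (tileS (snake es vs l))
  located-tileS vf ef lf = located
    (inj₁ ⊑-refl ∷ inj₁ ne⊒ ∷ vf)
    ((⊑-stepʸ ⊑-refl , inj₁ ne⊒) ∷ (⊑-refl , inj₁ ⊑-refl) ∷ (⊑-stepˣ ⊑-refl , inj₁ ne⊒) ∷ ef) lf
    where
    ne⊒ : nw ⊑ ne
    ne⊒ = ⊑-stepˣ ⊑-refl

  located-tileW : ∀ {vs es l} → All (Fresh sw sW) vs →
    All (λ e → sw ⊑ proj₁ e × Fresh sw sW (proj₂ e)) es → Fresh sw sW (proj₂ l) →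
    Located sw sW (tileW (snake es vs l))
  located-tileW vf ef lf = located
    (inj₁ ⊑-refl ∷ inj₁ ne⊒ ∷ vf)
    ((⊑-refl , inj₁ ⊑-refl) ∷ (⊑-stepʸ ⊑-refl , inj₁ ne⊒) ∷ (⊑-stepˣ ⊑-refl , inj₁ ne⊒) ∷ ef) lf
    where
    ne⊒ : se ⊑ ne
    ne⊒ = ⊑-stepʸ ⊑-refl

  extend-NS : ∀ {R} → Located nw sS R → Located sw sS (tileS R)
  extend-NS (located vf ef lf) = located-tileS (All.map fresh-NS vf)
    (All.map (λ { (p , f) → ⊑-stepʸ p , fresh-NS f }) ef) (fresh-NS lf)

  extend-ES : ∀ {R} → Located se sW R → Located sw sS (tileS R)
  extend-ES (located vf ef lf) = located-tileS (All.map fresh-ES vf)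
    (All.map (λ { (p , f) → ⊑-stepˣ p , fresh-ES f }) ef) (fresh-ES lf)

  extend-EW : ∀ {R} → Located se sW R → Located sw sW (tileW R)
  extend-EW (located vf ef lf) = located-tileW (All.map fresh-EW vf)
    (All.map (λ { (p , f) → ⊑-stepˣ p , fresh-EW f }) ef) (fresh-EW lf)

  extend-NW : ∀ {R} → Located nw sS R → Located sw sW (tileW R)
  extend-NW (located vf ef lf) = located-tileW (All.map fresh-NW vf)
    (All.map (λ { (p , f) → ⊑-stepʸ p , fresh-NW f }) ef) (fresh-NW lf)

open Tile

-- Matching counts along a whole snake graph

-- On no further signs `build` returns an empty snake whose last edge is the entering side of the
-- next tile, which is the exit side of this one. So the last tile obeys the same equation as the
-- others.
buildS-∷ : ∀ x y f g gs → build (x , y) sS f (g ∷ gs) ≡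
  tileS x y (if f ==ˢ g then build (suc x , y) sW g gs else build (x , suc y) sS g gs)
buildS-∷ x y plus  plus  []      = refl
buildS-∷ x y plus  plus  (_ ∷ _) = refl
buildS-∷ x y plus  minus []      = refl
buildS-∷ x y plus  minus (_ ∷ _) = refl
buildS-∷ x y minus plus  []      = refl
buildS-∷ x y minus plus  (_ ∷ _) = refl
buildS-∷ x y minus minus []      = refl
buildS-∷ x y minus minus (_ ∷ _) = refl

buildW-∷ : ∀ x y f g gs → build (x , y) sW f (g ∷ gs) ≡
  tileW x y (if f ==ˢ g then build (x , suc y) sS g gs else build (suc x , y) sW g gs)
buildW-∷ x y plus  plus  []      = refl
buildW-∷ x y plus  plus  (_ ∷ _) = refl
buildW-∷ x y plus  minus []      = refl
buildW-∷ x y plus  minus (_ ∷ _) = refl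
buildW-∷ x y minus plus  []      = refl
buildW-∷ x y minus plus  (_ ∷ _) = refl
buildW-∷ x y minus minus []      = refl
buildW-∷ x y minus minus (_ ∷ _) = refl

-- If u matchings leave both ends of the current edge free and v match both, then u + v is the
-- numerator and u the denominator of the continued fraction of the remaining signs.
fromCounts : Sign → ℕ → ℕ → ℕ × ℕ
fromCounts plus  u v = u , u + v
fromCounts minus u v = u + v , u

record State (h : Bool → Bool) (pos : Pt) (ent : Side) (f : Sign) (R : Snake) (vec : ℕ × ℕ) : Set where
  constructor state
  field
    {free matched} : ℕ
    position : Located pos ent R
    tally    : StateCounts h pos ent R free matched
    vec≡     : fromCounts f free matched ≡ vec

open State

EndState : (Bool → Bool) → ℕ × ℕ → ℕ → ℕ → Sign → Set
EndState h w x y f =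
  State h (x , y) sS f (build (x , y) sS f [ plus ]) (act f w) ×
  State h (x , y) sW f (build (x , y) sW f [ plus ]) (act f w)

-- In the coordinates of `fromCounts`, the transfer (u , v) ↦ (u + v , u) of a straight tile and (u
-- , v) ↦ (u , u + v) of a turn both become `act f`.
act-straight : ∀ f g {u v} → (f ==ˢ g) ≡ false → fromCounts f (u + v) u ≡ act f (fromCounts g u v)
act-straight plus  minus         _ = refl
act-straight minus plus  {u} {v} _ = cong₂ _,_ (+-comm (u + v) u) refl

act-turn : ∀ f g {u v} → (f ==ˢ g) ≡ true → fromCounts f u (u + v) ≡ act f (fromCounts g u v)
act-turn plus  plus          _ = refl
act-turn minus minus {u} {v} _ = cong₂ _,_ (+-comm u (u + v)) refl

module _ {h : Bool → Bool} {w : ℕ × ℕ} (end : ∀ x y f → EndState h w x y f) where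
  mutual
    -- A turn exchanges the entering sides, hence the mutual induction. The vector `w` stands for
    -- the closing + and is the only trace of the kind of matching counted.
    stateS : ∀ x y f gs → State h (x , y) sS f (build (x , y) sS f (gs ++ [ plus ])) (run (f ∷ gs) w)
    stateS x y f []       = proj₁ (end x y f)
    stateS x y f (g ∷ gs) rewrite buildS-∷ x y f g (gs ++ [ plus ]) with f ==ˢ g in eq
    ... | true  = let R = stateW (suc x) y g gs in
      state (extend-ES x y (position R)) (turnS x y (position R) (tally R))
            (trans (act-turn f g eq) (cong (act f) (vec≡ R)))
    ... | false = let R = stateS x (suc y) g gs in
      state (extend-NS x y (position R)) (straightS x y (position R) (tally R))
            (trans (act-straight f g eq) (cong (act f) (vec≡ R)))

    stateW : ∀ x y f gs → State h (x , y) sW f (build (x , y) sW f (gs ++ [ plus ])) (run (f ∷ gs) w)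
    stateW x y f []       = proj₂ (end x y f)
    stateW x y f (g ∷ gs) rewrite buildW-∷ x y f g (gs ++ [ plus ]) with f ==ˢ g in eq
    ... | true  = let R = stateS x (suc y) g gs in
      state (extend-NW x y (position R)) (turnW x y (position R) (tally R))
            (trans (act-turn f g eq) (cong (act f) (vec≡ R)))
    ... | false = let R = stateW (suc x) y g gs in
      state (extend-EW x y (position R)) (straightW x y (position R) (tally R))
            (trans (act-straight f g eq) (cong (act f) (vec≡ R)))

module LastTile {a b c d : Pt} (dist : Distinct a b c d) {es : List Edge} (te : TileEdges a b c d es) where
  open Distinct dist
  -- Only the degree equations are used below, so the last edge of the empty remainder is a
  -- placeholder; (a , a) qualifies since a differs from c and d.
  open TileStep id dist (snake [] [] (a , a)) [] (a≢c ∷ a≢d ∷ []) using (Split; split)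

  module _ (h : Bool → Bool) (l : Edge) (uses : Bool → Bool → Bool → Bool)
    (elem-l : ∀ p q r → elemᵉ l (choose te p q r []) ≡ uses p q r) where

    lastTile : Snake
    lastTile = snake (es ++ []) (c ∷ d ∷ []) l

    allowed : ℕ → ℕ → Bool → Bool → Bool → Bool
    allowed i j p q r = (bit q ≡ᵇ i) ∧ (bit r ≡ᵇ j) ∧ ((bit p + bit q ≡ᵇ 1) ∧ (bit p + bit r ≡ᵇ 1) ∧ true)
                        ∧ h (uses p q r)

    count-lastTile : ∀ i j →
      matchCount h a b lastTile i j ≡ sum₈ (λ p q r → if allowed i j p q r then 1 else 0)
    count-lastTile i j = trans (countSubsets-tile te (StatePred h a b lastTile i j) [])
      (sum₈-cong {f = λ p q r → countSubsets (StatePred h a b lastTile i j ∘ choose te p q r) []}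
        (λ p q r → cong (if_then 1 else 0) (pointwise p q r)))
      where
      pointwise : ∀ p q r → StatePred h a b lastTile i j (choose te p q r []) ≡ allowed i j p q r
      pointwise p q r
        rewrite Split.deg-a (split te p q r []) | Split.deg-b (split te p q r [])
          | Split.deg-c (split te p q r []) | Split.deg-d (split te p q r []) | elem-l p q r
          | +-identityʳ (bit q) | +-identityʳ (bit r) = refl

    counts-lastTile : let total = λ i j → sum₈ (λ p q r → if allowed i j p q r then 1 else 0) in
      ∀ {u v} → total 0 0 ≡ u → total 1 1 ≡ v → total 0 1 ≡ 0 → total 1 0 ≡ 0 →
      MatchCounts h a b lastTile u v
    counts-lastTile p q r s = counts (trans (count-lastTile 0 0) p) (trans (count-lastTile 1 1) q)
                                     (trans (count-lastTile 0 1) r) (trans (count-lastTile 1 0) s)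

  elem-straight : ∀ p q r → elemᵉ (c , d) (choose te p q r []) ≡ p
  elem-straight p q r = go te
    where
    ac≢ : ((c , d) ==ᵉ (a , c)) ≡ false
    ac≢ = ≢₁⇒==ᵉ (c , d) (a , c) (a≢c ∘ sym)
    bd≢ : ((c , d) ==ᵉ (b , d)) ≡ false
    bd≢ = ≢₁⇒==ᵉ (c , d) (b , d) (b≢c ∘ sym)
    go : ∀ {es} (te : TileEdges a b c d es) → elemᵉ (c , d) (choose te p q r []) ≡ p
    go enterS = trans (elem-opt-≡ p (c , d) _) (trans (cong (p ∨_)
      (trans (elem-opt-≢ q (c , d) _ _ ac≢) (elem-opt-≢ r (c , d) _ _ bd≢))) (∨-identityʳ p))
    go enterW = trans (elem-opt-≢ q (c , d) _ _ ac≢) (trans (elem-opt-≢ r (c , d) _ _ bd≢)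
      (trans (elem-opt-≡ p (c , d) _) (∨-identityʳ p)))

  elem-turn : ∀ p q r → elemᵉ (b , d) (choose te p q r []) ≡ r
  elem-turn p q r = go te
    where
    ac≢ : ((b , d) ==ᵉ (a , c)) ≡ false
    ac≢ = ≢₁⇒==ᵉ (b , d) (a , c) (a≢b ∘ sym)
    cd≢ : ((b , d) ==ᵉ (c , d)) ≡ false
    cd≢ = ≢₁⇒==ᵉ (b , d) (c , d) b≢c
    go : ∀ {es} (te : TileEdges a b c d es) → elemᵉ (b , d) (choose te p q r []) ≡ r
    go enterS = trans (elem-opt-≢ p (b , d) _ _ cd≢) (trans (elem-opt-≢ q (b , d) _ _ ac≢)
      (trans (elem-opt-≡ r (b , d) _) (∨-identityʳ r)))
    go enterW = trans (elem-opt-≢ q (b , d) _ _ ac≢) (trans (elem-opt-≡ r (b , d) _)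
      (trans (cong (r ∨_) (elem-opt-≢ p (b , d) _ _ cd≢)) (∨-identityʳ r)))

module _ (x y : ℕ) where
  private
    module S = LastTile (distinctS x y) enterS
    module W = LastTile (distinctW x y) enterW

    ne-freshS : Fresh (x , y) sS (suc x , suc y)
    ne-freshS = inj₁ (⊑-stepˣ ⊑-refl)

    ne-freshW : Fresh (x , y) sW (suc x , suc y)
    ne-freshW = inj₁ (⊑-stepʸ ⊑-refl)

    locS : ∀ {l} → proj₂ l ≡ (suc x , suc y) → Located (x , y) sS (tileS x y (snake [] [] l))
    locS refl = located-tileS x y [] [] ne-freshS

    locW : ∀ {l} → proj₂ l ≡ (suc x , suc y) → Located (x , y) sW (tileW x y (snake [] [] l))
    locW refl = located-tileW x y [] [] ne-freshW

  -- A single tile has one completion with a and b free, by cd, and one with both matched, by ac and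
  -- bd.
  all-end : ∀ f → EndState (const true) (1 , 1) x y f
  all-end plus =
    state (locS refl) (S.counts-lastTile _ _ _ S.elem-turn refl refl refl refl) refl ,
    state (locW refl) (W.counts-lastTile _ _ _ W.elem-turn refl refl refl refl) refl
  all-end minus =
    state (locS refl) (S.counts-lastTile _ _ _ S.elem-straight refl refl refl refl) refl ,
    state (locW refl) (W.counts-lastTile _ _ _ W.elem-straight refl refl refl refl) refl

  -- Of these two completions, the one by cd uses the last edge of a straight tile and the other
  -- uses that of a turn; in both cases the vector is `act f` of (0 , 1).
  last-end : ∀ f → EndState id (0 , 1) x y f
  last-end plus =
    state (locS refl) (S.counts-lastTile _ _ _ S.elem-turn refl refl refl refl) refl ,
    state (locW refl) (W.counts-lastTile _ _ _ W.elem-turn refl refl refl refl) refl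
  last-end minus =
    state (locS refl) (S.counts-lastTile _ _ _ S.elem-straight refl refl refl refl) refl ,
    state (locW refl) (W.counts-lastTile _ _ _ W.elem-straight refl refl refl refl) refl

-- Good matchings of the band graph

band : List Sign → Snake
band ss = build (0 , 0) sS plus (ss ++ [ plus ])

-- A good matching either contains the first edge, or avoids it and contains the last edge.
goodMatchings-split : ∀ ss {u₁ v₁ u₂ v₂} → Located (0 , 0) sS (band ss) →
  StateCounts (const true) (0 , 0) sS (band ss) u₁ v₁ → StateCounts id (0 , 0) sS (band ss) u₂ v₂ →
  goodMatchings (plus ∷ ss ++ [ plus ]) ≡ u₁ + v₂
goodMatchings-split ss (located vf ef _) c₁ c₂ =
  trans (countᵇ-subsets Good (firstEdge ∷ edges))
        (cong₂ _+_ (trans (countSubsets-cong ef with-first) (both-free c₁))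
                   (trans (countSubsets-cong ef without-first) (both-matched c₂)))
  where
  open Snake (band ss)
  open MatchCounts
  Good : Predᵇ
  Good M = isPerfectMatching ((0 , 0) ∷ (1 , 0) ∷ vertices) M ∧ (elemᵉ firstEdge M ∨ elemᵉ lastEdge M)

  FreshEdge : Edge → Set
  FreshEdge e = (0 , 0) ⊑ proj₁ e × Fresh (0 , 0) sS (proj₂ e)

  fresh≢ : ∀ {x w} → x ≤ 1 → Fresh (0 , 0) sS w → w ≢ (x , 0)
  fresh≢ x≤1 (inj₁ (_ , q)) = beyondʸ q
  fresh≢ x≤1 (inj₂ (p , _)) = beyondˣ (≤-trans (s≤s x≤1) p)

  with-first : ∀ M → All FreshEdge M → Good (firstEdge ∷ M) ≡ StatePred (const true) (0 , 0) (1 , 0) (band ss) 0 0 M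
  with-first M _ = begin
    (A ∧ B ∧ isPerfectMatching vertices (firstEdge ∷ M)) ∧ true  ≡⟨ ∧-assoc A _ _ ⟩
    A ∧ (B ∧ isPerfectMatching vertices (firstEdge ∷ M)) ∧ true  ≡⟨ cong (A ∧_) (∧-assoc B _ _) ⟩
    A ∧ B ∧ isPerfectMatching vertices (firstEdge ∷ M) ∧ true
      ≡⟨ cong (λ z → A ∧ B ∧ z ∧ true) (isPM-∷-avoid vertices firstEdge M
           (All.map (λ f → fresh≢ (z≤n) f , fresh≢ ≤-refl f) vf)) ⟩
    A ∧ B ∧ isPerfectMatching vertices M ∧ true ∎
    where
    open ≡-Reasoning
    A = deg (0 , 0) M ≡ᵇ 0
    B = deg (1 , 0) M ≡ᵇ 0

  first∉ : ∀ M → All FreshEdge M → elemᵉ firstEdge M ≡ false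
  first∉ []      []             = refl
  first∉ (e ∷ M) ((_ , f) ∷ fs)
    rewrite ≢₂⇒==ᵉ firstEdge e (fresh≢ ≤-refl f ∘ sym) = first∉ M fs

  without-first : ∀ M → All FreshEdge M → Good M ≡ StatePred id (0 , 0) (1 , 0) (band ss) 1 1 M
  without-first M fM = begin
    (A ∧ B ∧ C) ∧ (elemᵉ firstEdge M ∨ elemᵉ lastEdge M)  ≡⟨ cong (λ z → (A ∧ B ∧ C) ∧ (z ∨ elemᵉ lastEdge M)) (first∉ M fM) ⟩
    (A ∧ B ∧ C) ∧ elemᵉ lastEdge M                        ≡⟨ ∧-assoc A _ _ ⟩
    A ∧ (B ∧ C) ∧ elemᵉ lastEdge M                        ≡⟨ cong (A ∧_) (∧-assoc B _ _) ⟩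
    A ∧ B ∧ C ∧ elemᵉ lastEdge M                          ∎
    where
    open ≡-Reasoning
    A = deg (0 , 0) M ≡ᵇ 1
    B = deg (1 , 0) M ≡ᵇ 1
    C = isPerfectMatching vertices M

-- For a leading + the vector is (u , u + v). From (1 , 1) the first coordinate is a + b, from (0 ,
-- 1) the difference of the two is d; the sum a + (b + d) is the trace after prepending +.
goodMatchings-trace : ∀ ss → goodMatchings (plus ∷ ss ++ [ plus ]) ≡ Entries.trace (plus ∷ ss)
goodMatchings-trace ss = trans (goodMatchings-split ss (position s₁) (tally s₁) (tally s₂))
  (trans (cong₂ _+_ free≡ matched≡) (+-assoc a b d))
  where
  open Entries ss
  s₁ = stateS all-end 0 0 plus ss
  s₂ = stateS last-end 0 0 plus ss
  free≡ : free s₁ ≡ a + b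
  free≡ = trans (cong proj₁ (vec≡ s₁)) (cong proj₁ (run-⊞ (plus ∷ ss) e₁ e₂))
  matched≡ : matched s₂ ≡ d
  matched≡ = +-cancelˡ-≡ (free s₂) _ _ (trans (cong proj₂ (vec≡ s₂)) (cong (_+ d) (sym (cong proj₁ (vec≡ s₂)))))

-- Periodicity of the crossings and their signs

module Crossings where
  open import Data.Nat using (_*_)

  divN-+* : ∀ X n {L} → 0 < L → divN (X + n * L) L ≡ divN X L + n
  divN-+* X n {L@(suc _)} _ = trans (+-distrib-/-∣ʳ X (divides n refl)) (cong (X / L +_) (m*n/n≡m n L))

  modN-+* : ∀ X n {L} → 0 < L → modN (X + n * L) L ≡ modN X L
  modN-+* X n {L@(suc _)} _ = [m+kn]%n≡m%n X n L

  divN-< : ∀ {r L} → r < L → divN r L ≡ 0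
  divN-< {L = suc _} r<L = m<n⇒m/n≡0 r<L

  modN-< : ∀ {r L} → r < L → modN r L ≡ r
  modN-< {L = suc _} r<L = m<n⇒m%n≡m r<L

  modN≡0⇒∣ : ∀ X {L} → 0 < L → modN X L ≡ 0 → L ∣ X
  modN≡0⇒∣ X {L@(suc _)} _ eq = m%n≡0⇒n∣m X L eq

  divModN : ∀ X {L} → 0 < L → X ≡ modN X L + divN X L * L
  divModN X {L@(suc _)} _ = m≡m%n+[m/n]*n X L

  divModN-unique : ∀ {X L} d r → r < L → X ≡ r + d * L → divN X L ≡ d × modN X L ≡ r
  divModN-unique {L = L} d r r<L refl =
    trans (divN-+* r d (≤-<-trans z≤n r<L)) (cong (_+ d) (divN-< r<L)) ,
    trans (modN-+* r d (≤-<-trans z≤n r<L)) (modN-< r<L)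

  1+m+n∸m≡1+n : ∀ m n → suc (m + n) ∸ m ≡ suc n
  1+m+n∸m≡1+n m n = trans (cong (_∸ m) (sym (+-suc m n))) (m+n∸m≡n m (suc n))

  ∸-translate : ∀ m n a b → suc (m + n) + (a + b) ∸ (m + a) ≡ suc n + b
  ∸-translate m n a b = trans
    (cong (_∸ (m + a)) (solve 4 (λ m n a b → con 1 :+ (m :+ n) :+ (a :+ b) := m :+ a :+ (con 1 :+ n :+ b))
                          refl m n a b))
    (m+n∸m≡n (m + a) (suc n + b))

  <ᵇ-+ : ∀ n a b → (n + a <ᵇ n + b) ≡ (a <ᵇ b)
  <ᵇ-+ zero    a b = refl
  <ᵇ-+ (suc n) a b = <ᵇ-+ n a b

  ≡ᵇ-+ : ∀ n a b → (a + n ≡ᵇ b + n) ≡ (a ≡ᵇ b)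
  ≡ᵇ-+ n a b rewrite +-comm a n | +-comm b n = go n
    where
    go : ∀ n → (n + a ≡ᵇ n + b) ≡ (a ≡ᵇ b)
    go zero    = refl
    go (suc n) = go n

  ≥⇒<ᵇ : ∀ {m n} → n ≤ m → (m <ᵇ n) ≡ false
  ≥⇒<ᵇ {m}     {zero}  _         = refl
  ≥⇒<ᵇ {suc m} {suc n} (s≤s n≤m) = ≥⇒<ᵇ n≤m

  n≡ᵇ1+n : ∀ n → (n ≡ᵇ suc n) ≡ false
  n≡ᵇ1+n zero    = refl
  n≡ᵇ1+n (suc n) = n≡ᵇ1+n n

  1+n≡ᵇn : ∀ n → (suc n ≡ᵇ n) ≡ false
  1+n≡ᵇn zero    = refl
  1+n≡ᵇn (suc n) = 1+n≡ᵇn n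

  innerSigns-++ : ∀ xs c d ys →
    innerSigns (xs ++ c ∷ d ∷ ys) ≡ innerSigns (xs ++ [ c ]) ++ evenSign c d ∷ innerSigns (d ∷ ys)
  innerSigns-++ []           c d ys = refl
  innerSigns-++ (x ∷ [])     c d ys = refl
  innerSigns-++ (x ∷ y ∷ xs) c d ys =
    cong (λ ss → oddSign x ∷ evenSign x y ∷ ss) (innerSigns-++ (y ∷ xs) c d ys)

  ++-snoc : ∀ {A : Set} (xs ys zs : List A) {ws z} → ws ≡ zs ++ [ z ] →
    xs ++ ys ++ ws ≡ (xs ++ ys ++ zs) ++ [ z ]
  ++-snoc xs ys zs {z = z} refl =
    trans (cong (xs ++_) (sym (++-assoc ys zs [ z ]))) (sym (++-assoc xs (ys ++ zs) [ z ]))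

  take-length-+ : ∀ {A : Set} (xs : List A) m ys → take (length xs + m) (xs ++ ys) ≡ xs ++ take m ys
  take-length-+ []       m ys = refl
  take-length-+ (x ∷ xs) m ys = cong (x ∷_) (take-length-+ xs m ys)

  drop-length-+ : ∀ {A : Set} (xs : List A) m ys → drop (length xs + m) (xs ++ ys) ≡ drop m ys
  drop-length-+ []       m ys = refl
  drop-length-+ (x ∷ xs) m ys = drop-length-+ xs m ys

  closedSigns-cut : ∀ q p {a b cs} → let n = length (Path.pathCrossings q p 1) + 3 in
    drop (n ∸ 1) (Path.pathCrossings q p 2) ≡ a ∷ b ∷ cs →
    closedSigns q p ≡ evenSign a b ∷ innerSigns (take n (Path.pathCrossings q p 2)) ++ [ evenSign a b ]
  closedSigns-cut q p eq rewrite eq = refl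

  module Periodicity (p′ q′ : ℕ) (coprime : Coprime (suc p′) (suc q′)) where
    p q : ℕ
    p = suc p′
    q = suc q′
    open Path q p

    shift : ℕ → Pt → Pt
    shift j (x , y) = x + j * q , y + j * p

    translate : ℕ → Crossing → Crossing
    translate j (crossing u v near onRight) = crossing (shift j u) (shift j v) near onRight

    -- `translate` keeps the side test, which is right for that of the line, invariant under (q ,
    -- p), but not for a half-circle, which tests for its own centre.
    OnLine : Crossing → Set
    OnLine c = Crossing.onRight c ≡ rightOfLine

    rightOfLine-shift : ∀ j w → rightOfLine (shift j w) ≡ rightOfLine w
    rightOfLine-shift j (x , y) =
      trans (cong₂ _<ᵇ_ (solve 4 (λ q p j y → q :* (y :+ j :* p) := j :* p :* q :+ q :* y) refl q p j y)
                        (solve 4 (λ q p j x → p :* (x :+ j :* q) := j :* p :* q :+ p :* x) refl q p j x))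
            (<ᵇ-+ (j * p * q) (q * y) (p * x))

    ==ᵖ-shift : ∀ j v w → (shift j v ==ᵖ shift j w) ≡ (v ==ᵖ w)
    ==ᵖ-shift j (x , y) (x′ , y′) = cong₂ _∧_ (≡ᵇ-+ (j * q) x x′) (≡ᵇ-+ (j * p) y y′)

    oddSign-translate : ∀ j c → OnLine c → oddSign (translate j c) ≡ oddSign c
    oddSign-translate j (crossing u v nearU _) refl = cong sideSign (rightOfLine-shift j u)
    oddSign-translate j (crossing u v nearV _) refl = cong sideSign (rightOfLine-shift j v)
    oddSign-translate j (crossing u v atMid _) refl = refl

    evenSign-translate : ∀ j c d → OnLine c → evenSign (translate j c) (translate j d) ≡ evenSign c d
    evenSign-translate j c@(crossing u v _ _) d@(crossing u′ v′ _ _) refl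
      rewrite ==ᵖ-shift j u u′ | ==ᵖ-shift j u v′ with (u ==ᵖ u′) ∨ (u ==ᵖ v′)
    ... | true  = cong sideSign (rightOfLine-shift j u)
    ... | false = cong sideSign (rightOfLine-shift j v)

    innerSigns-translate : ∀ j {cs} → All OnLine cs → innerSigns (map (translate j) cs) ≡ innerSigns cs
    innerSigns-translate j []              = refl
    innerSigns-translate j {c ∷ []} (l ∷ []) = cong [_] (oddSign-translate j c l)
    innerSigns-translate j {c ∷ d ∷ _} (l ∷ ls@(_ ∷ _)) = cong₂ _∷_ (oddSign-translate j c l)
      (cong₂ _∷_ (evenSign-translate j c d l) (innerSigns-translate j ls))

    -- crossingsAt as a function of the floors dx, dy, dz and remainders of the
    -- coordinates x, y and of x + y.
    crossingsBy : (dx rx dy ry dz rz : ℕ) → List Crossing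
    crossingsBy dx rx dy ry dz rz =
      if (rx ≡ᵇ 0) ∧ (ry ≡ᵇ 0) then detour (dx , dy)
      else if rx ≡ᵇ 0 then [ crossing (dx , dy) (dx , suc dy) (comp ry L) rightOfLine ]
      else if ry ≡ᵇ 0 then [ crossing (dx , dy) (suc dx , dy) (comp rx L) rightOfLine ]
      else if rz ≡ᵇ 0 then [ crossing (dx , dz ∸ dx) (suc dx , dz ∸ dx ∸ 1) (comp rx L) rightOfLine ]
      else []

    -- The coordinate dz ∸ dx ∸ 1 on a segment of slope -1 commutes with translation only where
    -- nothing is truncated; dx < dz ensures that.
    crossingsBy-translate : ∀ j dx rx dy ry dz rz → ¬ (rx ≡ 0 × ry ≡ 0) → (rz ≡ 0 → rx ≢ 0 → dx < dz) →
      crossingsBy (dx + j * q) rx (dy + j * p) ry (dz + (j * q + j * p)) rz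
        ≡ map (translate j) (crossingsBy dx rx dy ry dz rz)
    crossingsBy-translate j dx zero     dy zero     dz rz       interior _ = contradiction (refl , refl) interior
    crossingsBy-translate j dx zero     dy (suc ry) dz rz       _ _ = refl
    crossingsBy-translate j dx (suc rx) dy zero     dz rz       _ _ = refl
    crossingsBy-translate j dx (suc rx) dy (suc ry) dz (suc rz) _ _ = refl
    crossingsBy-translate j dx (suc rx) dy (suc ry) dz zero     _ dx<dz
      with e , refl ← m≤n⇒∃[o]m+o≡n (dx<dz refl λ ())
      rewrite ∸-translate dx e (j * q) (j * p) | 1+m+n∸m≡1+n dx e = refl

    crossingsBy-onLine : ∀ dx rx dy ry dz rz → ¬ (rx ≡ 0 × ry ≡ 0) → All OnLine (crossingsBy dx rx dy ry dz rz)
    crossingsBy-onLine dx zero     dy zero     dz rz       interior = contradiction (refl , refl) interior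
    crossingsBy-onLine dx zero     dy (suc ry) dz rz       _ = refl ∷ []
    crossingsBy-onLine dx (suc rx) dy zero     dz rz       _ = refl ∷ []
    crossingsBy-onLine dx (suc rx) dy (suc ry) dz (suc rz) _ = []
    crossingsBy-onLine dx (suc rx) dy (suc ry) dz zero     _ = refl ∷ []

    0<L : 0 < L
    0<L = s≤s z≤n

    crossingsAt≡ : ∀ t dx rx dy ry dz rz →
      divN (t * q) L ≡ dx × modN (t * q) L ≡ rx → divN (t * p) L ≡ dy × modN (t * p) L ≡ ry →
      divN (t * q + t * p) L ≡ dz × modN (t * q + t * p) L ≡ rz →
      crossingsAt t ≡ crossingsBy dx rx dy ry dz rz
    crossingsAt≡ t _ _ _ _ _ _ (refl , refl) (refl , refl) (refl , refl) = refl

    -- Otherwise L divides both t q and t p, hence their gcd, which is t by coprimality, against 0 <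
    -- t < L. So no lattice point lies strictly inside a period.
    interior : ∀ {t} → 0 < t → t < L → ¬ (modN (t * q) L ≡ 0 × modN (t * p) L ≡ 0)
    interior {t@(suc _)} _ t<L (rx≡0 , ry≡0) = <⇒≱ t<L (∣⇒≤ (subst (L ∣_) gcd≡t
      (gcd-greatest (modN≡0⇒∣ (t * q) 0<L rx≡0) (modN≡0⇒∣ (t * p) 0<L ry≡0))))
      where
      gcd≡t : gcd (t * q) (t * p) ≡ t
      gcd≡t = trans (sym (c*gcd[m,n]≡gcd[cm,cn] t q p))
        (trans (cong (t *_) (trans (gcd-comm q p) (coprime⇒gcd≡1 coprime))) (*-identityʳ t))

    anti-floor : ∀ X Y → modN (X + Y) L ≡ 0 → modN X L ≢ 0 → divN X L < divN (X + Y) L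
    anti-floor X Y rz≡0 rx≢0 = *-cancelʳ-< L _ _ (begin-strict
      divN X L * L             <⟨ m<n+m (divN X L * L) (n≢0⇒n>0 rx≢0) ⟩
      modN X L + divN X L * L  ≡⟨ sym (divModN X 0<L) ⟩
      X                        ≤⟨ m≤m+n X Y ⟩
      X + Y                    ≡⟨ divModN (X + Y) 0<L ⟩
      modN (X + Y) L + divN (X + Y) L * L ≡⟨ cong (_+ divN (X + Y) L * L) rz≡0 ⟩
      divN (X + Y) L * L       ∎)
      where open ≤-Reasoning

    crossingsAt-translate : ∀ j {t} → 0 < t → t < L → crossingsAt (t + j * L) ≡ map (translate j) (crossingsAt t)
    crossingsAt-translate j {t} 0<t t<L = trans
      (crossingsAt≡ (t + j * L) _ _ _ _ _ _ (move (t * q) (j * q) X≡) (move (t * p) (j * p) Y≡)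
                    (move (t * q + t * p) (j * q + j * p) Z≡))
      (crossingsBy-translate j (divN (t * q) L) (modN (t * q) L) (divN (t * p) L) (modN (t * p) L)
        (divN (t * q + t * p) L) (modN (t * q + t * p) L) (interior 0<t t<L) (anti-floor (t * q) (t * p)))
      where
      move : ∀ X n {X′} → X′ ≡ X + n * L → divN X′ L ≡ divN X L + n × modN X′ L ≡ modN X L
      move X n refl = divN-+* X n 0<L , modN-+* X n 0<L
      X≡ : (t + j * L) * q ≡ t * q + j * q * L
      X≡ = solve 4 (λ t j L q → (t :+ j :* L) :* q := t :* q :+ j :* q :* L) refl t j L q
      Y≡ : (t + j * L) * p ≡ t * p + j * p * L
      Y≡ = solve 4 (λ t j L q → (t :+ j :* L) :* q := t :* q :+ j :* q :* L) refl t j L p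
      Z≡ : (t + j * L) * q + (t + j * L) * p ≡ t * q + t * p + (j * q + j * p) * L
      Z≡ = solve 5 (λ t j L q p → (t :+ j :* L) :* q :+ (t :+ j :* L) :* p
             := t :* q :+ t :* p :+ (j :* q :+ j :* p) :* L) refl t j L q p

    crossingsAt-onLine : ∀ {t} → 0 < t → t < L → All OnLine (crossingsAt t)
    crossingsAt-onLine {t} 0<t t<L = crossingsBy-onLine
      (divN (t * q) L) (modN (t * q) L) (divN (t * p) L) (modN (t * p) L)
      (divN (t * q + t * p) L) (modN (t * q + t * p) L) (interior 0<t t<L)

    crossingsDuring : ℕ → ℕ → List Crossing
    crossingsDuring s zero    = []
    crossingsDuring s (suc n) = crossingsAt s ++ crossingsDuring (suc s) n

    -- `f` is general because `applyUpTo` composes it with `suc` at each step.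
    concatMap-crossingsAt : ∀ {f} s n → (∀ i → f i ≡ i + s) →
      concatMap crossingsAt (applyUpTo f n) ≡ crossingsDuring s n
    concatMap-crossingsAt s zero    f≡ = refl
    concatMap-crossingsAt s (suc n) f≡ = cong₂ _++_ (cong crossingsAt (f≡ 0))
      (concatMap-crossingsAt (suc s) n (λ i → trans (f≡ (suc i)) (sym (+-suc i s))))

    crossingsDuring-+ : ∀ s m n →
      crossingsDuring s (m + n) ≡ crossingsDuring s m ++ crossingsDuring (s + m) n
    crossingsDuring-+ s zero    n rewrite +-identityʳ s = refl
    crossingsDuring-+ s (suc m) n rewrite +-suc s m =
      trans (cong (crossingsAt s ++_) (crossingsDuring-+ (suc s) m n))
            (sym (++-assoc (crossingsAt s) _ _))

    crossingsDuring-empty : ∀ s n → (∀ i → i < n → crossingsAt (s + i) ≡ []) → crossingsDuring s n ≡ []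
    crossingsDuring-empty s zero    empty = refl
    crossingsDuring-empty s (suc n) empty = cong₂ _++_
      (trans (cong crossingsAt (sym (+-identityʳ s))) (empty 0 (s≤s z≤n)))
      (crossingsDuring-empty (suc s) n
        (λ i i<n → trans (cong crossingsAt (sym (+-suc s i))) (empty (suc i) (s≤s i<n))))

    crossingsDuring-translate : ∀ j s n → 0 < s → s + n ≤ L →
      crossingsDuring (s + j * L) n ≡ map (translate j) (crossingsDuring s n)
    crossingsDuring-translate j s zero    _   _     = refl
    crossingsDuring-translate j s (suc n) 0<s s+n≤L = trans
      (cong₂ _++_ (crossingsAt-translate j 0<s (<-≤-trans (m<m+n s (s≤s z≤n)) s+n≤L))
                  (crossingsDuring-translate j (suc s) n (s≤s z≤n) (≤-trans (≤-reflexive (sym (+-suc s n))) s+n≤L)))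
      (sym (map-++ (translate j) (crossingsAt s) (crossingsDuring (suc s) n)))

    crossingsDuring-onLine : ∀ s n → 0 < s → s + n ≤ L → All OnLine (crossingsDuring s n)
    crossingsDuring-onLine s zero    _   _     = []
    crossingsDuring-onLine s (suc n) 0<s s+n≤L = All.++⁺
      (crossingsAt-onLine 0<s (<-≤-trans (m<m+n s (s≤s z≤n)) s+n≤L))
      (crossingsDuring-onLine (suc s) n (s≤s z≤n) (≤-trans (≤-reflexive (sym (+-suc s n))) s+n≤L))

    -- The line meets the lines x + y = i at the times that are multiples of c, and c is smaller
    -- than the spacing of the other two families; so the first and last crossings before (q , p),
    -- at times c and L - c = suc r′, are with segments of slope -1.
    c c′ r′ : ℕ
    c  = p * q
    c′ = q′ + p′ * q
    r′ = p′ + q′ + c′ * (p′ + q)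

    r≡ : suc r′ ≡ c * (p′ + q)
    r≡ = cong (_+ c′ * (p′ + q)) (sym (+-suc p′ q′))

    L≡ : L ≡ suc (r′ + c)
    L≡ = trans (*-suc c (p′ + q)) (trans (cong (c +_) (sym r≡)) (+-comm c (suc r′)))

    c*p+c*q≡L : c * p + c * q ≡ L
    c*p+c*q≡L = sym (*-distribˡ-+ c p q)

    c*p<L : c * p < L
    c*p<L = subst (c * p <_) c*p+c*q≡L (m<m+n (c * p) (s≤s z≤n))

    c*q<L : c * q < L
    c*q<L = subst (c * q <_) c*p+c*q≡L (m<n+m (c * q) (s≤s z≤n))

    anti<L : ∀ {i} → i < c → i * q + i * p < L
    anti<L {i} i<c = subst (i * q + i * p <_) (trans (+-comm (c * q) (c * p)) c*p+c*q≡L)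
      (+-mono-< (*-monoˡ-< q i<c) (*-monoˡ-< p i<c))

    crossingsAt-early : ∀ {t} → 0 < t → t < c → crossingsAt t ≡ []
    crossingsAt-early {t@(suc _)} _ t<c =
      crossingsAt≡ t 0 (t * q) 0 (t * p) 0 (t * q + t * p)
        (divModN-unique 0 (t * q) (≤-<-trans (*-monoˡ-≤ q (<⇒≤ t<c)) c*q<L) (sym (+-identityʳ _)))
        (divModN-unique 0 (t * p) (≤-<-trans (*-monoˡ-≤ p (<⇒≤ t<c)) c*p<L) (sym (+-identityʳ _)))
        (divModN-unique 0 (t * q + t * p) (anti<L t<c) (sym (+-identityʳ _)))

    crossingsAt-c : crossingsAt c ≡ [ crossing (0 , 1) (1 , 0) (comp (c * q) L) rightOfLine ]
    crossingsAt-c = crossingsAt≡ c 0 (c * q) 0 (c * p) 1 0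
      (divModN-unique 0 (c * q) c*q<L (sym (+-identityʳ _)))
      (divModN-unique 0 (c * p) c*p<L (sym (+-identityʳ _)))
      (divModN-unique 1 0 0<L (trans (+-comm (c * q) (c * p)) (trans c*p+c*q≡L (sym (+-identityʳ L)))))

    -- Since L = c p + c q, time L - c + i has x-coordinate q L - c q + i q = q′ L + (c p + i q),
    -- with remainder below L for i < c.
    late-x : ∀ i → (suc r′ + i) * q ≡ c * p + i * q + q′ * L
    late-x i = trans (cong (λ r → (r + i) * q) r≡) (solve 4 (λ p′ q′ c i →
      (c :* (p′ :+ (con 1 :+ q′)) :+ i) :* (con 1 :+ q′) :=
      c :* (con 1 :+ p′) :+ i :* (con 1 :+ q′) :+ q′ :* (c :* ((con 1 :+ p′) :+ (con 1 :+ q′)))) refl p′ q′ c i)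

    late-y : ∀ i → (suc r′ + i) * p ≡ c * q + i * p + p′ * L
    late-y i = trans (cong (λ r → (r + i) * p) r≡) (solve 4 (λ p′ q′ c i →
      (c :* (p′ :+ (con 1 :+ q′)) :+ i) :* (con 1 :+ p′) :=
      c :* (con 1 :+ q′) :+ i :* (con 1 :+ p′) :+ p′ :* (c :* ((con 1 :+ p′) :+ (con 1 :+ q′)))) refl p′ q′ c i)

    late-anti : ∀ i → (suc r′ + i) * q + (suc r′ + i) * p ≡ i * q + i * p + (q′ + p) * L
    late-anti i = trans (cong (λ r → (r + i) * q + (r + i) * p) r≡) (solve 4 (λ p′ q′ c i →
      (c :* (p′ :+ (con 1 :+ q′)) :+ i) :* (con 1 :+ q′) :+ (c :* (p′ :+ (con 1 :+ q′)) :+ i) :* (con 1 :+ p′) :=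
      i :* (con 1 :+ q′) :+ i :* (con 1 :+ p′) :+
        (q′ :+ (con 1 :+ p′)) :* (c :* ((con 1 :+ p′) :+ (con 1 :+ q′)))) refl p′ q′ c i)

    crossingsBy-late : ∀ i → i < c →
      crossingsAt (suc r′ + i) ≡ crossingsBy q′ (c * p + i * q) p′ (c * q + i * p) (q′ + p) (i * q + i * p)
    crossingsBy-late i i<c = crossingsAt≡ (suc r′ + i) _ _ _ _ _ _
      (divModN-unique q′ (c * p + i * q)
        (subst (c * p + i * q <_) c*p+c*q≡L (+-monoʳ-< (c * p) (*-monoˡ-< q i<c))) (late-x i))
      (divModN-unique p′ (c * q + i * p)
        (subst (c * q + i * p <_) (trans (+-comm (c * q) (c * p)) c*p+c*q≡L)
          (+-monoʳ-< (c * q) (*-monoˡ-< p i<c))) (late-y i))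
      (divModN-unique (q′ + p) (i * q + i * p) (anti<L i<c) (late-anti i))

    crossingsAt-late : ∀ {i} → 0 < i → i < c → crossingsAt (suc r′ + i) ≡ []
    crossingsAt-late {i@(suc _)} _ i<c = crossingsBy-late i i<c

    crossingsAt-r : crossingsAt (suc r′) ≡ [ crossing (q′ , p) (q , p′) (comp (c * p + 0) L) rightOfLine ]
    crossingsAt-r = trans (cong crossingsAt (sym (+-identityʳ (suc r′))))
      (trans (crossingsBy-late 0 (s≤s z≤n))
             (cong (λ y → [ crossing (q′ , y) (q , y ∸ 1) (comp (c * p + 0) L) rightOfLine ]) (m+n∸m≡n q′ p)))

    block : List Crossing
    block = crossingsDuring 1 (L ∸ 1)

    -- The end segments of a block are needed explicitly because they decide the even signs next to
    -- a half-circle.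
    block-head : ∃₂ λ n cs → block ≡ crossing (0 , 1) (1 , 0) n rightOfLine ∷ cs
    block-head = _ , _ , (begin
      crossingsDuring 1 (L ∸ 1)           ≡⟨ cong (crossingsDuring 1) (trans (cong (_∸ 1) L≡) (trans (+-suc r′ c′) (+-comm (suc r′) c′))) ⟩
      crossingsDuring 1 (c′ + suc r′)     ≡⟨ crossingsDuring-+ 1 c′ (suc r′) ⟩
      crossingsDuring 1 c′ ++ crossingsAt c ++ crossingsDuring (suc c) r′
        ≡⟨ cong₂ (λ xs ys → xs ++ ys ++ crossingsDuring (suc c) r′)
             (crossingsDuring-empty 1 c′ (λ i i<c′ → crossingsAt-early (s≤s z≤n) (s≤s i<c′))) crossingsAt-c ⟩
      _ ∎)
      where open ≡-Reasoning

    block-last : ∃₂ λ cs n → block ≡ cs ++ [ crossing (q′ , p) (q , p′) n rightOfLine ]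
    block-last = _ , _ , (begin
      crossingsDuring 1 (L ∸ 1)      ≡⟨ cong (λ n → crossingsDuring 1 (n ∸ 1)) L≡ ⟩
      crossingsDuring 1 (r′ + suc c′) ≡⟨ crossingsDuring-+ 1 r′ (suc c′) ⟩
      crossingsDuring 1 r′ ++ crossingsAt (suc r′) ++ crossingsDuring (2 + r′) c′
        ≡⟨ cong₂ (λ xs ys → crossingsDuring 1 r′ ++ xs ++ ys) crossingsAt-r
             (crossingsDuring-empty (2 + r′) c′ (λ i i<c′ →
               trans (cong crossingsAt (sym (+-suc (suc r′) i))) (crossingsAt-late (s≤s z≤n) (s≤s i<c′)))) ⟩
      _ ∎)
      where open ≡-Reasoning

    block-onLine : All OnLine block
    block-onLine = crossingsDuring-onLine 1 (L ∸ 1) (s≤s z≤n) ≤-refl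

    pathCrossings-1 : pathCrossings 1 ≡ block
    pathCrossings-1 = trans (concatMap-crossingsAt 1 (1 * L ∸ 1) (λ i → sym (+-comm i 1)))
                            (cong (λ n → crossingsDuring 1 (n ∸ 1)) (*-identityˡ L))

    crossingsAt-lattice : ∀ j → crossingsAt (j * L) ≡ detour (j * q , j * p)
    crossingsAt-lattice j = crossingsAt≡ (j * L) (j * q) 0 (j * p) 0 (j * q + j * p) 0
      (divModN-unique (j * q) 0 0<L (solve 3 (λ j L q → j :* L :* q := j :* q :* L) refl j L q))
      (divModN-unique (j * p) 0 0<L (solve 3 (λ j L q → j :* L :* q := j :* q :* L) refl j L p))
      (divModN-unique (j * q + j * p) 0 0<L
        (solve 4 (λ j L q p → j :* L :* q :+ j :* L :* p := (j :* q :+ j :* p) :* L) refl j L q p))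

    pathCrossings-suc : ∀ k → pathCrossings (2 + k) ≡
      pathCrossings (1 + k) ++ detour ((1 + k) * q , (1 + k) * p) ++ map (translate (1 + k)) block
    pathCrossings-suc k = begin
      pathCrossings (2 + k) ≡⟨ concatMap-crossingsAt 1 ((2 + k) * L ∸ 1) (λ i → sym (+-comm i 1)) ⟩
      crossingsDuring 1 ((2 + k) * L ∸ 1) ≡⟨ cong (crossingsDuring 1) times ⟩
      crossingsDuring 1 (M + suc (L ∸ 1)) ≡⟨ crossingsDuring-+ 1 M (suc (L ∸ 1)) ⟩
      crossingsDuring 1 M ++ crossingsAt ((1 + k) * L) ++ crossingsDuring (1 + (1 + k) * L) (L ∸ 1)
        ≡⟨ cong₂ _++_ (sym (concatMap-crossingsAt 1 M (λ i → sym (+-comm i 1))))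
            (cong₂ _++_ (crossingsAt-lattice (1 + k)) (crossingsDuring-translate (1 + k) 1 (L ∸ 1) (s≤s z≤n) ≤-refl)) ⟩
      pathCrossings (1 + k) ++ detour ((1 + k) * q , (1 + k) * p) ++ map (translate (1 + k)) block ∎
      where
      open ≡-Reasoning
      M = (1 + k) * L ∸ 1
      times : (2 + k) * L ∸ 1 ≡ M + L
      times = cong (_∸ 1) (+-comm L ((1 + k) * L))

    -- The five - come from three crossings close to the lattice point and from the two endpoints
    -- shared by consecutive ones; all are that point, which lies on the right.
    blockSigns detourSigns : List Sign
    blockSigns  = innerSigns block
    detourSigns = minus ∷ minus ∷ minus ∷ minus ∷ minus ∷ []

    innerSigns-detour : ∀ a b → innerSigns (detour (a , b)) ≡ detourSigns
    innerSigns-detour a b rewrite ≡ᵇ-refl a | ≡ᵇ-refl b | ≡ᵇ-refl a | ≡ᵇ-refl b = refl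

    lastCrossing firstCrossing : Near → Crossing
    lastCrossing  n = crossing (q′ , p) (q , p′) n rightOfLine
    firstCrossing n = crossing (0 , 1) (1 , 0) n rightOfLine

    translate-0 : ∀ n → translate 0 (lastCrossing n) ≡ lastCrossing n
    translate-0 n = cong₂ (λ u v → crossing u v n rightOfLine)
      (cong₂ _,_ (+-identityʳ q′) (+-identityʳ p)) (cong₂ _,_ (+-identityʳ q) (+-identityʳ p′))

    pathCrossings-last : ∀ k → ∃₂ λ cs n → pathCrossings (1 + k) ≡ cs ++ [ translate k (lastCrossing n) ]
    pathCrossings-last zero with cs , n , eq ← block-last =
      cs , n , trans pathCrossings-1 (trans eq (cong (λ c → cs ++ [ c ]) (sym (translate-0 n))))
    pathCrossings-last (suc k) = let cs , n , eq = block-last in _ , n , trans (pathCrossings-suc k)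
      (++-snoc (pathCrossings (1 + k)) (detour ((1 + k) * q , (1 + k) * p)) (map (translate (1 + k)) cs)
        (trans (cong (map (translate (1 + k))) eq) (map-++ (translate (1 + k)) cs [ lastCrossing n ])))

    -- The shared endpoint is the western neighbour of the lattice point, which lies to the left of
    -- the line.
    evenSign-enter : ∀ k n onR → evenSign (translate k (lastCrossing n))
      (crossing ((1 + k) * q , (1 + k) * p) ((1 + k) * q ∸ 1 , (1 + k) * p) nearU onR) ≡ plus
    evenSign-enter k n onR
      rewrite ==ᵖ-refl (q′ + k * q , p + k * p) | ∨-zeroʳ ((q′ + k * q , p + k * p) ==ᵖ ((1 + k) * q , (1 + k) * p))
      = cong sideSign (≥⇒<ᵇ (begin
        p * (q′ + k * q)  ≤⟨ *-monoʳ-≤ p (n≤1+n _) ⟩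
        p * (q + k * q)   ≡⟨ solve 3 (λ p q k → p :* (q :+ k :* q) := q :* (p :+ k :* p)) refl p q k ⟩
        q * (p + k * p)   ∎))
      where open ≤-Reasoning

    -- The shared endpoint is the northern neighbour of the lattice point, on the left of the
    -- half-circle.
    evenSign-leave : ∀ a b n onR → evenSign
      (crossing (a , b) (a , suc b) nearU (_==ᵖ (a , b))) (crossing (a , suc b) (suc a , b) n onR) ≡ plus
    evenSign-leave a b n onR rewrite ≡ᵇ-refl a | n≡ᵇ1+n b | n≡ᵇ1+n a | ≡ᵇ-refl a | 1+n≡ᵇn b = refl

    innerSigns-detour-++ : ∀ j n cs →
      innerSigns (detour (j * q , j * p) ++ translate j (firstCrossing n) ∷ cs)
        ≡ detourSigns ++ plus ∷ innerSigns (translate j (firstCrossing n) ∷ cs)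
    innerSigns-detour-++ j n cs = begin
      innerSigns (d₁ ∷ d₂ ∷ d₃ ∷ f ∷ cs)
        ≡⟨ innerSigns-++ (d₁ ∷ d₂ ∷ []) d₃ f cs ⟩
      innerSigns (detour (j * q , j * p)) ++ evenSign d₃ f ∷ innerSigns (f ∷ cs)
        ≡⟨ cong₂ (λ ss s → ss ++ s ∷ innerSigns (f ∷ cs)) (innerSigns-detour (j * q) (j * p))
                 (evenSign-leave (j * q) (j * p) n rightOfLine) ⟩
      detourSigns ++ plus ∷ innerSigns (f ∷ cs) ∎
      where
      open ≡-Reasoning
      P = j * q , j * p
      d₁ = crossing P (j * q ∸ 1 , j * p) nearU (_==ᵖ P)
      d₂ = crossing P (j * q ∸ 1 , suc (j * p)) nearU (_==ᵖ P)
      d₃ = crossing P (j * q , suc (j * p)) nearU (_==ᵖ P)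
      f = translate j (firstCrossing n)

    innerSigns-pathCrossings-detour : ∀ k ys →
      innerSigns (pathCrossings (1 + k) ++ detour ((1 + k) * q , (1 + k) * p) ++ ys)
        ≡ innerSigns (pathCrossings (1 + k)) ++ plus ∷ innerSigns (detour ((1 + k) * q , (1 + k) * p) ++ ys)
    innerSigns-pathCrossings-detour k ys with cs , n , eq ← pathCrossings-last k = begin
      innerSigns (pathCrossings (1 + k) ++ D ++ ys)  ≡⟨ cong (λ xs → innerSigns (xs ++ D ++ ys)) eq ⟩
      innerSigns ((cs ++ [ l ]) ++ D ++ ys)          ≡⟨ cong innerSigns (++-assoc cs [ l ] (D ++ ys)) ⟩
      innerSigns (cs ++ l ∷ D ++ ys)                 ≡⟨ innerSigns-++ cs l d₁ _ ⟩
      innerSigns (cs ++ [ l ]) ++ evenSign l d₁ ∷ innerSigns (D ++ ys)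
        ≡⟨ cong₂ (λ xs s → innerSigns xs ++ s ∷ innerSigns (D ++ ys)) (sym eq) (evenSign-enter k n (_==ᵖ P)) ⟩
      innerSigns (pathCrossings (1 + k)) ++ plus ∷ innerSigns (D ++ ys) ∎
      where
      open ≡-Reasoning
      D = detour ((1 + k) * q , (1 + k) * p)
      l = translate k (lastCrossing n)
      P = (1 + k) * q , (1 + k) * p
      d₁ = crossing P ((1 + k) * q ∸ 1 , (1 + k) * p) nearU (_==ᵖ P)

    innerSigns-pathCrossings-suc : ∀ k → innerSigns (pathCrossings (2 + k)) ≡
      innerSigns (pathCrossings (1 + k)) ++ plus ∷ detourSigns ++ plus ∷ blockSigns
    innerSigns-pathCrossings-suc k with n , cs , eq ← block-head = begin
      innerSigns (pathCrossings (2 + k))             ≡⟨ cong innerSigns (pathCrossings-suc k) ⟩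
      innerSigns (pathCrossings (1 + k) ++ D ++ B)   ≡⟨ innerSigns-pathCrossings-detour k B ⟩
      S ++ plus ∷ innerSigns (D ++ B)                ≡⟨ cong (λ b → S ++ plus ∷ innerSigns (D ++ b)) B≡ ⟩
      S ++ plus ∷ innerSigns (D ++ translate (1 + k) (firstCrossing n) ∷ map (translate (1 + k)) cs)
        ≡⟨ cong (λ ss → S ++ plus ∷ ss) (innerSigns-detour-++ (1 + k) n _) ⟩
      S ++ plus ∷ detourSigns ++ plus ∷ innerSigns (translate (1 + k) (firstCrossing n) ∷ map (translate (1 + k)) cs)
        ≡⟨ cong (λ b → S ++ plus ∷ detourSigns ++ plus ∷ innerSigns b) (sym B≡) ⟩
      S ++ plus ∷ detourSigns ++ plus ∷ innerSigns B
        ≡⟨ cong (λ ss → S ++ plus ∷ detourSigns ++ plus ∷ ss) (innerSigns-translate (1 + k) block-onLine) ⟩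
      S ++ plus ∷ detourSigns ++ plus ∷ blockSigns   ∎
      where
      open ≡-Reasoning
      D = detour ((1 + k) * q , (1 + k) * p)
      B = map (translate (1 + k)) block
      S = innerSigns (pathCrossings (1 + k))
      B≡ : B ≡ translate (1 + k) (firstCrossing n) ∷ map (translate (1 + k)) cs
      B≡ = cong (map (translate (1 + k))) eq

    closedSigns≡ : closedSigns q p ≡ plus ∷ (blockSigns ++ plus ∷ detourSigns) ++ [ plus ]
    closedSigns≡ with n , cs , eq ← block-head = begin
      closedSigns q p
        ≡⟨ closedSigns-cut q p (trans drop≡ (cong (λ b → d₃ ∷ map (translate 1) b) eq)) ⟩
      (let s = evenSign d₃ (translate 1 (firstCrossing n)) in
        s ∷ innerSigns (take (length (pathCrossings 1) + 3) (pathCrossings 2)) ++ [ s ])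
        ≡⟨ cong₂ (λ s ss → s ∷ ss ++ [ s ]) (evenSign-leave (1 * q) (1 * p) n rightOfLine) signs≡ ⟩
      plus ∷ (blockSigns ++ plus ∷ detourSigns) ++ [ plus ] ∎
      where
      open ≡-Reasoning
      D = detour (1 * q , 1 * p)
      d₃ = crossing (1 * q , 1 * p) (1 * q , suc (1 * p)) nearU (_==ᵖ (1 * q , 1 * p))
      drop≡ : drop (length (pathCrossings 1) + 3 ∸ 1) (pathCrossings 2) ≡ d₃ ∷ map (translate 1) block
      drop≡ = trans
        (cong₂ drop (cong (_∸ 1) (+-suc (length (pathCrossings 1)) 2)) (pathCrossings-suc 0))
        (drop-length-+ (pathCrossings 1) 2 _)
      signs≡ : innerSigns (take (length (pathCrossings 1) + 3) (pathCrossings 2)) ≡ blockSigns ++ plus ∷ detourSigns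
      signs≡ = begin
        innerSigns (take (length (pathCrossings 1) + 3) (pathCrossings 2))
          ≡⟨ cong (λ cs → innerSigns (take (length (pathCrossings 1) + 3) cs)) (pathCrossings-suc 0) ⟩
        innerSigns (take (length (pathCrossings 1) + 3) (pathCrossings 1 ++ D ++ map (translate 1) block))
          ≡⟨ cong innerSigns (take-length-+ (pathCrossings 1) 3 _) ⟩
        innerSigns (pathCrossings 1 ++ D)
          ≡⟨ innerSigns-pathCrossings-detour 0 [] ⟩
        innerSigns (pathCrossings 1) ++ plus ∷ innerSigns D
          ≡⟨ cong₂ (λ xs ss → innerSigns xs ++ plus ∷ ss) pathCrossings-1 (innerSigns-detour (1 * q) (1 * p)) ⟩
        blockSigns ++ plus ∷ detourSigns ∎

open Crossings

-- The recurrence from the matrix of one period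

module Recurrence (p′ q′ : ℕ) (coprime : Coprime (suc p′) (suc q′)) where
  open Periodicity p′ q′ coprime using (p; q; blockSigns; detourSigns; closedSigns≡; pathCrossings-1; innerSigns-pathCrossings-suc)
  open Path q p using (pathCrossings)
  open Entries blockSigns
  open ≡-Reasoning

  period : List Sign
  period = plus ∷ detourSigns ++ plus ∷ blockSigns

  u : ℕ × ℕ
  u = 1 , 1

  -- The free vector `v` absorbs whole periods from the end of the path, so three consecutive values
  -- become one linear form applied to three vectors.
  afterMinus : ℕ → ℕ × ℕ → ℕ
  afterMinus k v = proj₁ (run (minus ∷ innerSigns (pathCrossings (1 + k))) v)

  afterMinus-suc : ∀ k v → afterMinus (suc k) v ≡ afterMinus k (run period v)
  afterMinus-suc k v = trans (cong (λ ss → proj₁ (run (minus ∷ ss) v)) (innerSigns-pathCrossings-suc k))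
                           (cong proj₁ (run-++ (minus ∷ innerSigns (pathCrossings (suc k))) period v))

  mLat≡ : ∀ k → mLat q p (suc k) ≡ afterMinus k u
  mLat≡ k = cfNumerator-run (innerSigns (pathCrossings (suc k)))

  afterMinus-0 : ∀ v → afterMinus 0 v ≡ proj₁ (run (minus ∷ blockSigns) v)
  afterMinus-0 v = cong (λ cs → proj₁ (run (minus ∷ innerSigns cs) v)) pathCrossings-1

  -- Both sign sequences describe the same closed curve cut at different points; the equality is
  -- invariance of the trace under cyclic rotation.
  mCirc≡ : mCirc q p ≡ Entries.trace period
  mCirc≡ = begin
    goodMatchings (closedSigns q p)                      ≡⟨ cong goodMatchings closedSigns≡ ⟩
    goodMatchings (plus ∷ W ++ [ plus ])                 ≡⟨ goodMatchings-trace W ⟩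
    Entries.trace (plus ∷ W)
      -- (1 , 1) and (5 , 6) are the columns of the matrix of + followed by five -.
      ≡⟨ cong₂ (λ v w → proj₁ v + (proj₁ w + proj₂ w))
           (trans (run-++ blockSigns (plus ∷ detourSigns) e₁) (run-entries 1 1))
           (trans (run-++ blockSigns (plus ∷ detourSigns) e₂) (run-entries 5 6)) ⟩
    _
      ≡⟨ solve 4 (λ a b c d → let s = a :+ c ; t = b :+ d in
           a :* con 1 :+ b :* con 1 :+ (a :* con 5 :+ b :* con 6 :+ (c :* con 5 :+ d :* con 6)) :=
           a :+ s :+ s :+ s :+ s :+ s :+ (b :+ t :+ t :+ t :+ t :+ t :+ t)) refl a b c d ⟩
    Entries.trace period ∎
    where W = blockSigns ++ plus ∷ detourSigns

  mLat-2 : mLat q p 2 ≡ mCirc q p ℕ.* mLat q p 1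
  mLat-2 = begin
    mLat q p 2                           ≡⟨ mLat≡ 1 ⟩
    afterMinus 1 u                       ≡⟨ afterMinus-suc 0 u ⟩
    afterMinus 0 (run period u)          ≡⟨ afterMinus-0 (run period u) ⟩
    sumOf (run blockSigns (run period u)) ≡⟨ cong (λ v → sumOf (run blockSigns (run (plus ∷ detourSigns ++ [ plus ]) v))) (run-entries 1 1) ⟩
    sumOf (run blockSigns (run (plus ∷ detourSigns ++ [ plus ]) (a ℕ.* 1 + b ℕ.* 1 , c ℕ.* 1 + d ℕ.* 1)))
      ≡⟨ cong sumOf (run-entries _ _) ⟩
    _
      -- Here (w , w + z) is D applied to (x , y). As polynomials the sides differ by (a d - b c)
      -- times the entry sum of D⁻¹, up to sign, and that sum is 0.
      ≡⟨ solve 4 (λ a b c d → let s = a :+ c ; t = b :+ d ; x = a :* con 1 :+ b :* con 1 ; y = c :* con 1 :+ d :* con 1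
                                  z = x :+ y ; w = x :+ z :+ z :+ z :+ z :+ z in
           a :* w :+ b :* (w :+ z) :+ (c :* w :+ d :* (w :+ z)) :=
           (a :+ s :+ s :+ s :+ s :+ s :+ (b :+ t :+ t :+ t :+ t :+ t :+ t)) :* (x :+ y)) refl a b c d ⟩
    Entries.trace period ℕ.* sumOf (a ℕ.* 1 + b ℕ.* 1 , c ℕ.* 1 + d ℕ.* 1)
      ≡⟨ cong₂ ℕ._*_ (sym mCirc≡) (sym (trans (mLat≡ 0) (trans (afterMinus-0 u) (cong sumOf (run-entries 1 1))))) ⟩
    mCirc q p ℕ.* mLat q p 1             ∎
    where
    sumOf : ℕ × ℕ → ℕ
    sumOf (x , y) = x + y

  recurrence : ∀ k → mLat q p (2 + k) + mLat q p k ≡ mCirc q p ℕ.* mLat q p (1 + k)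
  recurrence zero    = trans (+-identityʳ _) mLat-2
  recurrence (suc k) = begin
    mLat q p (3 + k) + mLat q p (1 + k)
      ≡⟨ cong₂ _+_ (trans (mLat≡ (2 + k)) (trans (afterMinus-suc (1 + k) u) (afterMinus-suc k (run period u)))) (mLat≡ k) ⟩
    afterMinus k (run period (run period u)) + afterMinus k u
      ≡⟨ cong proj₁ (sym (run-⊞ ss (run period (run period u)) u)) ⟩
    afterMinus k (run period (run period u) ⊞ u)
      ≡⟨ cong (afterMinus k) (cayleyHamilton period u) ⟩
    afterMinus k (Entries.trace period ⊡ run period u)
      ≡⟨ cong proj₁ (run-⊡ ss (Entries.trace period) (run period u)) ⟩
    Entries.trace period ℕ.* afterMinus k (run period u)
      ≡⟨ cong₂ ℕ._*_ (sym mCirc≡) (sym (trans (mLat≡ (1 + k)) (afterMinus-suc k u))) ⟩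
    mCirc q p ℕ.* mLat q p (2 + k) ∎
    where ss = minus ∷ innerSigns (pathCrossings (1 + k))

open import Data.Integer using (ℤ; +_; _*_; _-_)
import Data.Integer.Properties as ℤ

theorem5p6 : (p q k : ℕ) → 1 ≤ p → p ≤ q → Coprime p q → 2 ≤ k →
    + mLat q p k ≡ (+ mCirc q p) * (+ mLat q p (k ∸ 1)) - (+ mLat q p (k ∸ 2))
theorem5p6 (suc p′) (suc q′) (suc (suc k)) (s≤s _) (s≤s _) coprime (s≤s (s≤s _)) = begin
  + m₂                       ≡⟨ sym (trans (ℤ.[+m]-[+n]≡m⊖n (m₂ + m₀) m₀)
                                     (trans (ℤ.⊖-≥ (m≤n+m m₀ m₂)) (cong +_ (m+n∸n≡m m₂ m₀)))) ⟩
  + (m₂ + m₀) - + m₀         ≡⟨ cong (λ n → + n - + m₀) (Recurrence.recurrence p′ q′ coprime k) ⟩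
  + (t ℕ.* m₁) - + m₀        ≡⟨ cong (_- + m₀) (ℤ.pos-* t m₁) ⟩
  + t * + m₁ - + m₀          ∎
  where
  open ≡-Reasoning
  t = mCirc (suc q′) (suc p′)
  m₀ = mLat (suc q′) (suc p′) k
  m₁ = mLat (suc q′) (suc p′) (suc k)
  m₂ = mLat (suc q′) (suc p′) (suc (suc k))
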